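{- Let $\ell\le 0\le r$ be integers and let $(n_i)_{\ell\le i\le r}$ be a sequence of positive integers. The number of embedded rooted Cayley trees having vertical profile $(n_\ell,\ldots,n_{ -1};n_0,n_1,\ldots,n_r)$ is $$\frac{n_0}{n_\ell n_r}\,\frac{n!}{\prod_{i=\ell}^r (n_i-1)!}\prod_{i=\ell}^{r}(n_{i-1}+n_{i+1})^{n_i-1},$$ where $n=\sum_i n_i$ and $n_{\ell-1}=n_{r+1}=0$.
   Context: A rooted Cayley tree of size $n$ is a tree (acyclic connected graph) on the vertex set $\{1,\ldots,n\}$ with a distinguished vertex $\rho$, the root. An embedding of such a tree in $\mathbb{Z}$ is a map $a:\{1,\ldots,n\}\to\mathbb{Z}$ with $a(\rho)=0$ and $|a(v)-a(v')|=1$ whenever $v,v'$ are neighbours; an embedded rooted Cayley tree is a pair (tree, embedding), and pairs are counted as distinct whenever the tree or the map differs. The vertical profile is $(n_\ell,\ldots,n_{ -1};n_0,\ldots,n_r)$, where $n_i$ is the number of vertices with $a(v)=i$ and $\ell$ (resp. $r$) is the smallest (resp. largest) abscissa occurring. -}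

module Defs where

open import Level using (0ℓ)
open import Data.Bool using (Bool; true; false)
open import Data.Nat as ℕ using (ℕ; suc; _∸_; _<_)
open import Data.Nat.Base using (_!)
open import Relation.Nullary using (yes; no)
open import Data.Integer as ℤ using (ℤ; +_; ∣_∣; _-_; _≟_)
open import Data.Fin using (Fin)
open import Data.List using (List; []; _∷_; _++_; [_]; length; map; upTo; allFin; filter)
open import Data.Nat.ListAction using (sum; product)
open import Data.List.Relation.Unary.Linked using (Linked)
open import Data.List.Relation.Unary.Unique.Propositional using (Unique)
open import Data.Product using (Σ; _×_; ∃)
open import Data.Empty using (⊥)
open import Relation.Binary using (Setoid; IsEquivalence)
open import Relation.Binary.Construct.Closure.ReflexiveTransitive using (Star)
open import Relation.Binary.PropositionalEquality using (_≡_; refl; sym; trans)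

-- Simple graphs on the vertex set Fin n (vertices 1..n ↦ 0..n-1),
-- given by a Boolean adjacency relation.

Adj : ∀ {n} → (Fin n → Fin n → Bool) → Fin n → Fin n → Set
Adj E u v = E u v ≡ true

HasCycle : ∀ {n} → (Fin n → Fin n → Bool) → Set
HasCycle {n} E = Σ (Fin n) λ x → Σ (List (Fin n)) λ ys →
  (2 ℕ.≤ length ys) × Unique (x ∷ ys) × Linked (Adj E) (x ∷ ys ++ [ x ])

Connected : ∀ {n} → (Fin n → Fin n → Bool) → Set
Connected {n} E = (u v : Fin n) → Star (Adj E) u v

IsTree : ∀ {n} → (Fin n → Fin n → Bool) → Set
IsTree {n} E =
  ((u v : Fin n) → E u v ≡ E v u) ×
  ((u : Fin n) → E u u ≡ false) ×
  Connected E ×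
  (HasCycle E → ⊥)

record EmbTree (n : ℕ) : Set where
  field
    edges      : Fin n → Fin n → Bool
    root       : Fin n
    emb        : Fin n → ℤ
    isTree     : IsTree edges
    emb-root   : emb root ≡ + 0
    emb-edge   : (u v : Fin n) → Adj edges u v → ∣ emb u - emb v ∣ ≡ 1

_≈ET_ : ∀ {n} → EmbTree n → EmbTree n → Set
_≈ET_ {n} t t' =
  ((u v : Fin n) → EmbTree.edges t u v ≡ EmbTree.edges t' u v) ×
  (EmbTree.root t ≡ EmbTree.root t') ×
  ((u : Fin n) → EmbTree.emb t u ≡ EmbTree.emb t' u)

EmbTreeSetoid : ℕ → Setoid 0ℓ 0ℓ
EmbTreeSetoid n = record
  { Carrier = EmbTree n
  ; _≈_ = _≈ET_
  ; isEquivalence = record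
    { refl = (λ u v → refl) Data.Product., refl Data.Product., (λ u → refl)
    ; sym = λ (e Data.Product., r Data.Product., a) →
        (λ u v → sym (e u v)) Data.Product., sym r Data.Product., (λ u → sym (a u))
    ; trans = λ (e Data.Product., r Data.Product., a) (e' Data.Product., r' Data.Product., a') →
        (λ u v → trans (e u v) (e' u v)) Data.Product., trans r r' Data.Product., (λ u → trans (a u) (a' u))
    }
  }

-- the integers ℓ, ℓ+1, …, r  (assuming ℓ ≤ r)
range : ℤ → ℤ → List ℤ
range ℓ r = map (λ k → ℓ ℤ.+ + k) (upTo (suc ∣ r - ℓ ∣))

levelCount : ∀ {n} → (Fin n → ℤ) → ℤ → ℕ
levelCount {n} a i = length (filter (λ v → a v ≟ i) (allFin n))

ext : ℤ → ℤ → (ℤ → ℕ) → ℤ → ℕ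
ext ℓ r m i with ℓ ℤ.≤? i | i ℤ.≤? r
... | yes _ | yes _ = m i
... | _ | _ = 0

HasProfile : ∀ {n} → ℤ → ℤ → (ℤ → ℕ) → (Fin n → ℤ) → Set
HasProfile ℓ r m a = (i : ℤ) → levelCount a i ≡ ext ℓ r m i

size : ℤ → ℤ → (ℤ → ℕ) → ℕ
size ℓ r m = sum (map m (range ℓ r))

ProfiledSetoid : (ℓ r : ℤ) (m : ℤ → ℕ) → Setoid 0ℓ 0ℓ
ProfiledSetoid ℓ r m = record
  { Carrier = Σ (EmbTree (size ℓ r m)) λ t → HasProfile ℓ r m (EmbTree.emb t)
  ; _≈_ = λ s s' → Data.Product.proj₁ s ≈ET Data.Product.proj₁ s'
  ; isEquivalence = record
    { refl = λ {s} → Setoid.refl S {Data.Product.proj₁ s}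
    ; sym = λ {s} {s'} → Setoid.sym S {Data.Product.proj₁ s} {Data.Product.proj₁ s'}
    ; trans = λ {s} {s'} {s''} → Setoid.trans S {Data.Product.proj₁ s} {Data.Product.proj₁ s'} {Data.Product.proj₁ s''} }
  }
  where S = EmbTreeSetoid (size ℓ r m)

denom : ℤ → ℤ → (ℤ → ℕ) → ℕ
denom ℓ r m = m ℓ ℕ.* m r ℕ.* product (map (λ i → (m i ∸ 1) !) (range ℓ r))

numer : ℤ → ℤ → (ℤ → ℕ) → ℕ
numer ℓ r m = m (+ 0) ℕ.* (size ℓ r m) ! ℕ.*
  product (map (λ i → (ext ℓ r m (i - + 1) ℕ.+ ext ℓ r m (i ℤ.+ + 1)) ℕ.^ (m i ∸ 1)) (range ℓ r))

{-# OPTIONS --safe #-}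
module Submission where

-- Fix the abscissas a of the vertices.  A rooted tree is a parent map g : V → Maybe V
-- that is acyclic and takes the value nothing exactly once, at abscissa 0.
-- Let u ≠ v have the same abscissa, and fix g outside u and v.  Cutting g at u and v,
-- every path ends at u, at v, or at the root; say that a value has type U, V or R
-- accordingly.  Then g is acyclic iff (g u , g v) has type (R,R), (R,U) or (V,R), while
-- "u redirected to v" is acyclic iff g v has type R.  Exchanging g u and g v when g v has
-- type U is therefore a bijection from the acyclic g onto the g that become acyclic once
-- u is redirected to v; the value g u is now free.  Doing this for every vertex u other
-- than a chosen representative v of its level, what remains to be acyclic is a map on the
-- levels ℓ, …, r moving by ±1, so each representative must move towards 0.
-- Thus a level i contributes (n_{i-1} + n_{i+1})^(n_i - 1) times the size of the level
-- next to i in the direction of 0 (times 1 if i = 0), and the multinomial coefficient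
-- counts the choices of a.

open import Defs
open import Level using (0ℓ)
open import Algebra.Bundles using (AbelianGroup)
open import Algebra.Properties.Group using (∙-cancelˡ)
open import Data.Bool using (Bool; true; false)
open import Data.Empty using (⊥; ⊥-elim)
open import Data.Fin using (Fin; zero; suc; toℕ; fromℕ<; join; splitAt; combine; remQuot)
open import Data.Fin.Permutation.Components using (transpose)
import Data.Fin.Properties as Finₚ
open import Data.Integer as ℤ using (ℤ; +_; +[1+_]; -[1+_]; ∣_∣; _-_; _≟_; _≤_)
import Data.Integer.Properties as ℤₚ
open import Data.Integer.Tactic.RingSolver using (solve-∀)
open import Data.List using (List; []; _∷_; [_]; _++_; length; map; filter; tabulate; allFin; upTo; applyUpTo)
open import Data.List.Membership.Propositional using (_∈_)
open import Data.List.Membership.Propositional.Properties using (∈-allFin; ∈-filter⁺; ∈-filter⁻; ∈-map⁺; ∈-map⁻; ∈-upTo⁺; ∈-upTo⁻)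
open import Data.List.Properties using (map-cong-local; map-tabulate; map-upTo; map-∘; filter-accept; filter-reject)
open import Data.List.Relation.Unary.All as All using (All; []; _∷_)
open import Data.List.Relation.Unary.All.Properties using (¬Any⇒All¬)
open import Data.List.Relation.Unary.AllPairs as AllPairs using ([]; _∷_)
open import Data.List.Relation.Unary.Any as Any using (here; there)
open import Data.List.Relation.Unary.Linked using (Linked; []; [-]; _∷_)
open import Data.List.Relation.Unary.Unique.Propositional using (Unique)
open import Data.List.Relation.Unary.Unique.Propositional.Properties using (allFin⁺; filter⁺; map⁺; upTo⁺)
open import Data.Maybe using (Maybe; just; nothing)
open import Data.Maybe.Properties using (just-injective) renaming (≡-dec to Maybe-≡-dec)
open import Data.Nat as ℕ using (ℕ; zero; suc; _+_; _*_; _∸_; _^_; _<_; _!; z≤n; s≤s)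
open import Data.Nat.ListAction using (sum; product)
import Data.Nat.Properties as ℕₚ
open import Data.Nat.Tactic.RingSolver using () renaming (solve-∀ to solve-∀ℕ)
open import Data.Product using (Σ; ∃; _×_; _,_; proj₁; proj₂)
open import Data.Product.Relation.Binary.Pointwise.NonDependent using (×-setoid)
open import Data.Sum as Sum using (_⊎_; inj₁; inj₂)
open import Function using (_∘_; id)
open import Function.Bundles using (Inverse)
import Function.Construct.Composition as Compose
open import Relation.Binary using (Setoid)
import Relation.Binary.Construct.On as On
open import Relation.Binary.Construct.Closure.ReflexiveTransitive as Star using (Star; ε; _◅_; _◅◅_)
open import Relation.Binary.PropositionalEquality using (_≡_; _≢_; _≗_; refl; sym; trans; cong; cong₂; subst; subst₂; setoid; _→-setoid_; module ≡-Reasoning)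
open import Relation.Nullary using (¬_; Dec; yes; no; does)
open import Relation.Nullary.Decidable using (_⊎-dec_; _×-dec_; dec-true; dec-false)
open import Relation.Unary using (Decidable)

open Inverse using (to; from; to-cong; strictlyInverseˡ; strictlyInverseʳ)

-- Finite sizes of setoids

mkInverse : {S T : Setoid 0ℓ 0ℓ} → let open Setoid in
  (f : Carrier S → Carrier T) (g : Carrier T → Carrier S) →
  (∀ {x y} → _≈_ S x y → _≈_ T (f x) (f y)) →
  (∀ {x y} → _≈_ T x y → _≈_ S (g x) (g y)) →
  (∀ y → _≈_ T (f (g y)) y) → (∀ x → _≈_ S (g (f x)) x) →
  Inverse S T
mkInverse {S} {T} f g f-cong g-cong fg gf = record
  { to = f ; from = g ; to-cong = f-cong ; from-cong = g-cong
  ; inverse = (λ {y} e → Setoid.trans T (f-cong e) (fg y))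
            , (λ {x} e → Setoid.trans S (g-cong e) (gf x)) }

-- Equality ignores the proof of `P`, so an element is counted once however many proofs it has.
Sub : (S : Setoid 0ℓ 0ℓ) → (Setoid.Carrier S → Set) → Setoid 0ℓ 0ℓ
Sub S P = On.setoid S (proj₁ {B = P})

HasSize : Setoid 0ℓ 0ℓ → ℕ → Set
HasSize S N = Inverse S (setoid (Fin N))

module _ {S : Setoid 0ℓ 0ℓ} where
  open Setoid S using (Carrier; _≈_) renaming (refl to ≈-refl; sym to ≈-sym)

  Sub-resp : {P Q : Carrier → Set} → (∀ x → P x → Q x) → (∀ x → Q x → P x) →
    Inverse (Sub S P) (Sub S Q)
  Sub-resp P⇒Q Q⇒P = mkInverse (λ (x , p) → x , P⇒Q x p) (λ (x , q) → x , Q⇒P x q)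
    id id (λ _ → ≈-refl) (λ _ → ≈-refl)

  HasSize-resp : {P Q : Carrier → Set} {N : ℕ} → (∀ x → P x → Q x) → (∀ x → Q x → P x) →
    HasSize (Sub S P) N → HasSize (Sub S Q) N
  HasSize-resp P⇒Q Q⇒P = Compose.inverse (Sub-resp Q⇒P P⇒Q)

  HasSize-⊥ : {P : Carrier → Set} → (∀ x → P x → ⊥) → HasSize (Sub S P) 0
  HasSize-⊥ ¬P = mkInverse (λ (x , p) → ⊥-elim (¬P x p)) (λ ())
    (λ {(x , p)} → ⊥-elim (¬P x p)) (λ { {()} }) (λ ()) (λ (x , p) → ⊥-elim (¬P x p))

  HasSize-1 : {P : Carrier → Set} (x : Carrier) → P x → (∀ y → P y → x ≈ y) → HasSize (Sub S P) 1
  HasSize-1 x p uniq = mkInverse (λ _ → zero) (λ _ → x , p) (λ _ → refl) (λ _ → ≈-refl)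
    (λ { zero → refl }) (λ (y , q) → uniq y q)

  -- Equality does not see the tags, so the numbering is well defined only because equal elements
  -- cannot carry different tags. This is where disjointness enters.
  HasSize-⊎ : {P Q : Carrier → Set} {M N : ℕ} → HasSize (Sub S P) M → HasSize (Sub S Q) N →
    (∀ {x y} → x ≈ y → P x → Q y → ⊥) → HasSize (Sub S (λ x → P x ⊎ Q x)) (M + N)
  HasSize-⊎ {P} {Q} {M} {N} p↔ q↔ disj = mkInverse f g (λ {s} {t} → f-cong s t) g-cong f∘g g∘f
    where
    f : (Σ Carrier λ x → P x ⊎ Q x) → Fin (M + N)
    f (x , inj₁ p) = join M N (inj₁ (to p↔ (x , p)))
    f (x , inj₂ q) = join M N (inj₂ (to q↔ (x , q)))
    h : Fin M ⊎ Fin N → Σ Carrier λ x → P x ⊎ Q x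
    h (inj₁ i) = proj₁ (from p↔ i) , inj₁ (proj₂ (from p↔ i))
    h (inj₂ j) = proj₁ (from q↔ j) , inj₂ (proj₂ (from q↔ j))
    g : Fin (M + N) → Σ Carrier λ x → P x ⊎ Q x
    g k = h (splitAt M k)
    f-cong : ∀ s t → proj₁ s ≈ proj₁ t → f s ≡ f t
    f-cong (_ , inj₁ p) (_ , inj₁ p') e = cong (join M N ∘ inj₁) (to-cong p↔ e)
    f-cong (_ , inj₁ p) (_ , inj₂ q) e = ⊥-elim (disj e p q)
    f-cong (_ , inj₂ q) (_ , inj₁ p) e = ⊥-elim (disj (≈-sym e) p q)
    f-cong (_ , inj₂ q) (_ , inj₂ q') e = cong (join M N ∘ inj₂) (to-cong q↔ e)
    g-cong : ∀ {i j} → i ≡ j → proj₁ (g i) ≈ proj₁ (g j)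
    g-cong refl = ≈-refl
    f∘h : ∀ k → f (h k) ≡ join M N k
    f∘h (inj₁ i) = cong (join M N ∘ inj₁) (strictlyInverseˡ p↔ i)
    f∘h (inj₂ j) = cong (join M N ∘ inj₂) (strictlyInverseˡ q↔ j)
    f∘g : ∀ k → f (g k) ≡ k
    f∘g k = trans (f∘h (splitAt M k)) (Finₚ.join-splitAt M N k)
    g∘f : ∀ s → proj₁ (g (f s)) ≈ proj₁ s
    g∘f (x , inj₁ p) rewrite Finₚ.splitAt-join M N (inj₁ (to p↔ (x , p))) = strictlyInverseʳ p↔ (x , p)
    g∘f (x , inj₂ q) rewrite Finₚ.splitAt-join M N (inj₂ (to q↔ (x , q))) = strictlyInverseʳ q↔ (x , q)

  HasSize-fibres : {A : Set} {P : Carrier → Set} (φ : Carrier → A) → (∀ {x y} → x ≈ y → φ x ≡ φ y) →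
    (c : A → ℕ) {L : List A} → Unique L →
    (∀ {i} → i ∈ L → HasSize (Sub S (λ x → P x × φ x ≡ i)) (c i)) →
    HasSize (Sub S (λ x → P x × φ x ∈ L)) (sum (map c L))
  HasSize-fibres φ φ-cong c {[]} _ _ = HasSize-⊥ (λ { _ (_ , ()) })
  HasSize-fibres {P = P} φ φ-cong c {i ∷ L} (i∉L ∷ uniq) fibre = HasSize-resp merge split
    (HasSize-⊎ (fibre (here refl)) (HasSize-fibres φ φ-cong c uniq (fibre ∘ there))
      (λ e (_ , φx≡i) (_ , φy∈L) → All.lookup i∉L φy∈L (trans (sym φx≡i) (φ-cong e))))
    where
    merge : ∀ x → (P x × φ x ≡ i) ⊎ (P x × φ x ∈ L) → P x × φ x ∈ (i ∷ L)
    merge x (inj₁ (p , e)) = p , here e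
    merge x (inj₂ (p , m)) = p , there m
    split : ∀ x → P x × φ x ∈ (i ∷ L) → (P x × φ x ≡ i) ⊎ (P x × φ x ∈ L)
    split x (p , here e) = inj₁ (p , e)
    split x (p , there m) = inj₂ (p , m)

HasSize-∈ : {A : Set} {L : List A} → Unique L → HasSize (Sub (setoid A) (_∈ L)) (length L)
HasSize-∈ {L = []} _ = HasSize-⊥ (λ { _ () })
HasSize-∈ {L = x ∷ L} (x∉L ∷ uniq) = HasSize-resp
  (λ { _ (inj₁ e) → here (sym e) ; _ (inj₂ m) → there m })
  (λ { _ (here e) → inj₁ (sym e) ; _ (there m) → inj₂ m })
  (HasSize-⊎ (HasSize-1 {P = x ≡_} x refl (λ _ e → e)) (HasSize-∈ uniq)
    (λ { refl refl m → All.lookup x∉L m refl }))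

HasSize-Π : ∀ {n} {B : Set} (P : Fin n → B → Set) (c : Fin n → ℕ) →
  (∀ v → HasSize (Sub (setoid B) (P v)) (c v)) →
  HasSize (Sub (Fin n →-setoid B) (λ g → ∀ v → P v (g v))) (product (tabulate c))
HasSize-Π {zero} P c sizes = HasSize-1 (λ ()) (λ ()) (λ _ _ ())
HasSize-Π {suc n} {B} P c sizes = mkInverse f g (λ {s} {t} → f-cong s t) g-cong f∘g g∘f
  where
  N = product (tabulate (c ∘ suc))
  head = sizes zero
  tail = HasSize-Π (P ∘ suc) (c ∘ suc) (sizes ∘ suc)
  f : (Σ (Fin (suc n) → B) λ g → ∀ v → P v (g v)) → Fin (c zero * N)
  f (g , p) = combine (to head (g zero , p zero)) (to tail (g ∘ suc , p ∘ suc))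
  glue : Fin (c zero) × Fin N → Σ (Fin (suc n) → B) λ g → ∀ v → P v (g v)
  glue (i , j) = (λ { zero → proj₁ (from head i) ; (suc v) → proj₁ (from tail j) v })
               , (λ { zero → proj₂ (from head i) ; (suc v) → proj₂ (from tail j) v })
  g : Fin (c zero * N) → Σ (Fin (suc n) → B) λ g → ∀ v → P v (g v)
  g k = glue (remQuot N k)
  f-cong : ∀ s t → proj₁ s ≗ proj₁ t → f s ≡ f t
  f-cong s t e = cong₂ combine (to-cong head (e zero)) (to-cong tail (e ∘ suc))
  g-cong : ∀ {i j} → i ≡ j → proj₁ (g i) ≗ proj₁ (g j)
  g-cong refl _ = refl
  f∘g : ∀ k → f (g k) ≡ k
  f∘g k = trans (cong₂ combine (strictlyInverseˡ head (proj₁ (remQuot N k)))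
                               (strictlyInverseˡ tail (proj₂ (remQuot {c zero} N k))))
                (Finₚ.combine-remQuot {c zero} N k)
  g∘f : ∀ s → proj₁ (g (f s)) ≗ proj₁ s
  g∘f (h , p) v = trans
    (cong (λ k → proj₁ (glue k) v)
      (Finₚ.remQuot-combine (to head (h zero , p zero)) (to tail (h ∘ suc , p ∘ suc))))
    (glued v)
    where
    glued : proj₁ (glue (to head (h zero , p zero) , to tail (h ∘ suc , p ∘ suc))) ≗ h
    glued zero = strictlyInverseʳ head (h zero , p zero)
    glued (suc w) = strictlyInverseʳ tail (h ∘ suc , p ∘ suc) w

-- The second component may depend on the first, as long as the number of choices does not. Fibres
-- are numbered over the chosen elements `point k`; `Q-resp` moves an element over any `a` into the
-- fibre over the chosen element equal to `a`.
HasSize-Σ : {A B : Setoid 0ℓ 0ℓ} → let open Setoid in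
  {P : Carrier A → Set} {Q : Carrier A → Carrier B → Set} →
  (∀ {a a' b} → _≈_ A a a' → Q a b → Q a' b) → ∀ {M N} →
  HasSize (Sub A P) M → (∀ a → P a → HasSize (Sub B (Q a)) N) →
  HasSize (Sub (×-setoid A B) (λ (a , b) → P a × Q a b)) (M * N)
HasSize-Σ {A} {B} {P} {Q} Q-resp {M} {N} base fibre =
  mkInverse f (glue ∘ remQuot N) (λ {s} {t} → f-cong s t)
    (λ { {i} refl → Setoid.refl A×B {proj₁ (glue (remQuot N i))} })
    f∘g g∘f
  where
  A×B = ×-setoid A B
  point : Fin M → Setoid.Carrier A
  point k = proj₁ (from base k)
  over : ∀ k → HasSize (Sub B (Q (point k))) N
  over k = fibre (point k) (proj₂ (from base k))
  f : (Σ (Setoid.Carrier A×B) λ (a , b) → P a × Q a b) → Fin (M * N)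
  f ((a , b) , p , q) = combine k (to (over k) (b , Q-resp (Setoid.sym A (strictlyInverseʳ base (a , p))) q))
    where k = to base (a , p)
  glue : Fin M × Fin N → Σ (Setoid.Carrier A×B) λ (a , b) → P a × Q a b
  glue (k , j) = (point k , proj₁ (from (over k) j)) , proj₂ (from base k) , proj₂ (from (over k) j)
  combine-cong : ∀ {k k' b b'} → k ≡ k' → Setoid._≈_ B b b' → (q : Q (point k) b) (q' : Q (point k') b') →
    combine k (to (over k) (b , q)) ≡ combine k' (to (over k') (b' , q'))
  combine-cong {k} refl e q q' = cong (combine k) (to-cong (over k) e)
  f-cong : ∀ s t → Setoid._≈_ A×B (proj₁ s) (proj₁ t) → f s ≡ f t
  f-cong _ _ (ea , eb) = combine-cong (to-cong base ea) eb _ _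
  f∘g : ∀ i → f (glue (remQuot N i)) ≡ i
  f∘g i = let (k , j) = remQuot {M} N i in begin
    f (glue (k , j))
      ≡⟨ combine-cong (strictlyInverseˡ base k) (Setoid.refl B) _ (proj₂ (from (over k) j)) ⟩
    combine k (to (over k) (from (over k) j))     ≡⟨ cong (combine k) (strictlyInverseˡ (over k) j) ⟩
    combine k j                                   ≡⟨ Finₚ.combine-remQuot {M} N i ⟩
    i                                             ∎
    where open ≡-Reasoning
  g∘f : ∀ s → Setoid._≈_ A×B (proj₁ (glue (remQuot N (f s)))) (proj₁ s)
  g∘f ((a , b) , p , q) = Setoid.trans A×B
    (Setoid.reflexive A×B (cong (proj₁ ∘ glue) (Finₚ.remQuot-combine k j)))
    (strictlyInverseʳ base (a , p) , strictlyInverseʳ (over k) _)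
    where
    k = to base (a , p)
    j = to (over k) (b , Q-resp (Setoid.sym A (strictlyInverseʳ base (a , p))) q)

-- Counting labellings with a given profile

map-cong-∈ : {A : Set} {f g : A → ℕ} {L : List A} → (∀ {x} → x ∈ L → f x ≡ g x) → map f L ≡ map g L
map-cong-∈ e = map-cong-local (All.tabulate e)

x*[y*z]≡y*[x*z] : ∀ x y z → x * (y * z) ≡ y * (x * z)
x*[y*z]≡y*[x*z] = solve-∀ℕ

product-update : {A : Set} {f g : A → ℕ} {h : ℕ} {i : A} {L : List A} → Unique L → i ∈ L →
  f i ≡ h * g i → (∀ j → j ≢ i → f j ≡ g j) → product (map f L) ≡ h * product (map g L)
product-update {f = f} {g} {h} {L = i ∷ L} (i∉L ∷ _) (here refl) eᵢ e = begin
  f i * product (map f L)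
    ≡⟨ cong₂ (λ x l → x * product l) eᵢ (map-cong-∈ (λ m → e _ (λ j≡i → All.lookup i∉L m (sym j≡i)))) ⟩
  h * g i * product (map g L)   ≡⟨ ℕₚ.*-assoc h (g i) _ ⟩
  h * (g i * product (map g L)) ∎
  where open ≡-Reasoning
product-update {f = f} {g} {h} {L = j ∷ L} (j∉L ∷ uniq) (there m) eᵢ e = begin
  f j * product (map f L)       ≡⟨ cong₂ _*_ (e j (All.lookup j∉L m)) (product-update {h = h} uniq m eᵢ e) ⟩
  g j * (h * product (map g L)) ≡⟨ x*[y*z]≡y*[x*z] (g j) h _ ⟩
  h * (g j * product (map g L)) ∎
  where open ≡-Reasoning

sum-update : {A : Set} {f g : A → ℕ} {i : A} {L : List A} → Unique L → i ∈ L →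
  f i ≡ suc (g i) → (∀ j → j ≢ i → f j ≡ g j) → sum (map f L) ≡ suc (sum (map g L))
sum-update {L = i ∷ L} (i∉L ∷ _) (here refl) eᵢ e =
  cong₂ (λ x l → x + sum l) eᵢ (map-cong-∈ (λ m → e _ (λ j≡i → All.lookup i∉L m (sym j≡i))))
sum-update {g = g} {L = j ∷ L} (j∉L ∷ uniq) (there m) eᵢ e =
  trans (cong₂ _+_ (e j (All.lookup j∉L m)) (sum-update uniq m eᵢ e)) (ℕₚ.+-suc (g j) _)

sum≡0⇒≡0 : {A : Set} (μ : A → ℕ) {M : List A} → sum (map μ M) ≡ 0 → ∀ {i} → i ∈ M → μ i ≡ 0
sum≡0⇒≡0 μ {x ∷ M} e (here refl) = ℕₚ.m+n≡0⇒m≡0 (μ x) e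
sum≡0⇒≡0 μ {x ∷ M} e (there m) = sum≡0⇒≡0 μ (ℕₚ.m+n≡0⇒n≡0 (μ x) e) m

sum-*ʳ : {A : Set} (f : A → ℕ) (k : ℕ) (L : List A) → sum (map f L) * k ≡ sum (map (λ x → f x * k) L)
sum-*ʳ f k [] = refl
sum-*ʳ f k (x ∷ L) = trans (ℕₚ.*-distribʳ-+ k (f x) (sum (map f L))) (cong₂ _+_ refl (sum-*ʳ f k L))

decrement : (ℤ → ℕ) → ℤ → ℤ → ℕ
decrement μ i j with j ≟ i
... | yes _ = μ j ∸ 1
... | no _ = μ j

decrement-≡ : ∀ (μ : ℤ → ℕ) i {k} → μ i ≡ suc k → suc (decrement μ i i) ≡ μ i
decrement-≡ μ i e with i ≟ i
... | yes _ rewrite e = refl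
... | no i≢i = ⊥-elim (i≢i refl)

decrement-≢ : ∀ (μ : ℤ → ℕ) i j → j ≢ i → μ j ≡ decrement μ i j
decrement-≢ μ i j j≢i with j ≟ i
... | yes j≡i = ⊥-elim (j≢i j≡i)
... | no _ = refl

length-filter-map : {A B : Set} {P : B → Set} (P? : Decidable P) (f : A → B) (xs : List A) →
  length (filter P? (map f xs)) ≡ length (filter (P? ∘ f) xs)
length-filter-map P? f [] = refl
length-filter-map P? f (x ∷ xs) with P? (f x)
... | yes _ = cong suc (length-filter-map P? f xs)
... | no _ = length-filter-map P? f xs


levelCount-tail : ∀ {n} (a : Fin (suc n) → ℤ) (i : ℤ) →
  length (filter (λ v → a v ≟ i) (tabulate suc)) ≡ levelCount (a ∘ suc) i
levelCount-tail a i = trans (cong (λ l → length (filter (λ v → a v ≟ i) l)) (sym (map-tabulate id suc)))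
  (length-filter-map (λ v → a v ≟ i) suc (allFin _))

levelCount-≡ : ∀ {n} (a : Fin (suc n) → ℤ) (i : ℤ) → a zero ≡ i →
  levelCount a i ≡ suc (levelCount (a ∘ suc) i)
levelCount-≡ a i e with a zero ≟ i
... | yes _ = cong suc (levelCount-tail a i)
... | no ne = ⊥-elim (ne e)

levelCount-≢ : ∀ {n} (a : Fin (suc n) → ℤ) (i : ℤ) → a zero ≢ i →
  levelCount a i ≡ levelCount (a ∘ suc) i
levelCount-≢ a i ne with a zero ≟ i
... | yes e = ⊥-elim (ne e)
... | no _ = levelCount-tail a i

LabelSetoid : ℕ → (ℤ → ℕ) → Setoid 0ℓ 0ℓ
LabelSetoid n μ = Sub (Fin n →-setoid ℤ) (λ a → ∀ i → levelCount a i ≡ μ i)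

-- The multinomial coefficient, by recursion on the abscissa of the first vertex. `labelsWithHead`
-- receives `μ i` as a separate argument in order to branch on it: no labelling starts at an empty
-- level.
multinomial : ℕ → (ℤ → ℕ) → List ℤ → ℕ
labelsWithHead : ℕ → ℕ → (ℤ → ℕ) → List ℤ → ℤ → ℕ
multinomial zero μ L = 1
multinomial (suc n) μ L = sum (map (λ i → labelsWithHead (μ i) n μ L i) L)
labelsWithHead zero n μ L i = 0
labelsWithHead (suc _) n μ L i = multinomial n (decrement μ i) L

module _ {L : List ℤ} (uniq : Unique L) where

  decrement-sum : ∀ {n k} (μ : ℤ → ℕ) {i} → i ∈ L → μ i ≡ suc k → sum (map μ L) ≡ suc n → sum (map (decrement μ i) L) ≡ n
  decrement-sum μ {i} m eᵢ e = ℕₚ.suc-injective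
    (trans (sym (sum-update uniq m (sym (decrement-≡ μ i eᵢ)) (decrement-≢ μ i))) e)

  decrement-support : ∀ (μ : ℤ → ℕ) i → (∀ j → 0 < μ j → j ∈ L) → ∀ j → 0 < decrement μ i j → j ∈ L
  decrement-support μ i supp j p with j ≟ i
  ... | yes refl = supp j (ℕₚ.≤-trans p (ℕₚ.m∸n≤m (μ j) 1))
  ... | no _ = supp j p

  -- Taking one factor `μ i` out of `μ i !` leaves the factorials of `decrement μ i`, so by
  -- induction the term for `i` becomes `μ i * n !`. Summing over `i` gives `suc n * n !`.
  multinomial-factorials : ∀ n (μ : ℤ → ℕ) → sum (map μ L) ≡ n →
    multinomial n μ L * product (map (λ i → μ i !) L) ≡ n !
  multinomial-factorials zero μ e = trans (ℕₚ.*-identityˡ _) (ones μ {L} (sum≡0⇒≡0 μ e))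
    where
    ones : ∀ (μ : ℤ → ℕ) {M : List ℤ} → (∀ {i} → i ∈ M → μ i ≡ 0) → product (map (λ i → μ i !) M) ≡ 1
    ones μ {[]} _ = refl
    ones μ {x ∷ M} z rewrite z (here refl) = trans (ℕₚ.*-identityˡ _) (ones μ (z ∘ there))
  multinomial-factorials (suc n) μ e = begin
    sum (map c L) * Π                ≡⟨ sum-*ʳ c Π L ⟩
    sum (map (λ i → c i * Π) L)      ≡⟨ cong sum (map-cong-∈ λ {i} m → term m (μ i) refl) ⟩
    sum (map (λ i → μ i * n !) L)    ≡⟨ sum-*ʳ μ (n !) L ⟨
    sum (map μ L) * n !              ≡⟨ cong (_* n !) e ⟩
    suc n * n !                      ∎
    where
    open ≡-Reasoning
    c = λ i → labelsWithHead (μ i) n μ L i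
    Π = product (map (λ i → μ i !) L)
    term : ∀ {i} → i ∈ L → ∀ k → μ i ≡ k → labelsWithHead k n μ L i * Π ≡ k * n !
    term m zero eᵢ = refl
    term {i} m (suc k) eᵢ = begin
      multinomial n μ' L * Π
        ≡⟨ cong (multinomial n μ' L *_)
             (product-update {h = suc k} uniq m factor (λ j ne → cong _! (decrement-≢ μ i j ne))) ⟩
      multinomial n μ' L * (suc k * product (map (λ j → μ' j !) L))
        ≡⟨ x*[y*z]≡y*[x*z] (multinomial n μ' L) (suc k) _ ⟩
      suc k * (multinomial n μ' L * product (map (λ j → μ' j !) L))
        ≡⟨ cong (suc k *_) (multinomial-factorials n μ' (decrement-sum μ m eᵢ e)) ⟩
      suc k * n ! ∎
      where
      μ' = decrement μ i
      factor : μ i ! ≡ suc k * (μ' i) !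
      factor rewrite sym (ℕₚ.suc-injective (trans (decrement-≡ μ i eᵢ) eᵢ)) | sym (decrement-≡ μ i eᵢ) = refl

  -- Split by the abscissa of vertex `zero`, which lies in `L` because its level is occupied.
  -- Deleting this vertex lowers the profile by one at that level.
  multinomial-labels : ∀ n (μ : ℤ → ℕ) → (∀ j → 0 < μ j → j ∈ L) → sum (map μ L) ≡ n →
    HasSize (LabelSetoid n μ) (multinomial n μ L)
  multinomial-labels zero μ supp e = HasSize-1 (λ ()) (λ i → sym (vanish i)) (λ _ _ ())
    where
    vanish : ∀ i → μ i ≡ 0
    vanish i with μ i in eᵢ
    ... | zero = refl
    ... | suc k = trans (sym eᵢ) (sum≡0⇒≡0 μ {L} e (supp i (subst (0 <_) (sym eᵢ) (s≤s z≤n))))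
  multinomial-labels (suc n) μ supp e = HasSize-resp (λ _ → proj₁) (λ a p → p , supp (a zero) (head-positive a p))
    (HasSize-fibres (λ a → a zero) (λ e → e zero) (λ i → labelsWithHead (μ i) n μ L i) uniq
      (λ {i} m → fibre m (μ i) refl))
    where
    head-positive : ∀ (a : Fin (suc n) → ℤ) → (∀ i → levelCount a i ≡ μ i) → 0 < μ (a zero)
    head-positive a p = subst (0 <_) (trans (sym (levelCount-≡ a (a zero) refl)) (p (a zero))) (s≤s z≤n)
    fibre : ∀ {i} → i ∈ L → ∀ k → μ i ≡ k →
      HasSize (Sub (Fin (suc n) →-setoid ℤ) (λ a → (∀ j → levelCount a j ≡ μ j) × a zero ≡ i)) (labelsWithHead k n μ L i)
    fibre m zero eᵢ = HasSize-⊥ λ { a (p , refl) → ℕₚ.<⇒≢ (head-positive a p) (sym eᵢ) }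
    fibre {i} m (suc k) eᵢ = Compose.inverse
      (mkInverse (λ (a , p , e₀) → a ∘ suc , tail-profile a p e₀) (λ (a , p) → cons a , cons-profile a p , refl)
        (λ e → e ∘ suc) (λ { e zero → refl ; e (suc v) → e v }) (λ _ _ → refl)
        (λ { (_ , _ , e₀) zero → sym e₀ ; _ (suc v) → refl }))
      (multinomial-labels n (decrement μ i) (decrement-support μ i supp) (decrement-sum μ m eᵢ e))
      where
      cons : (Fin n → ℤ) → Fin (suc n) → ℤ
      cons a zero = i
      cons a (suc v) = a v
      tail-profile : ∀ (a : Fin (suc n) → ℤ) → (∀ j → levelCount a j ≡ μ j) → a zero ≡ i →
        ∀ j → levelCount (a ∘ suc) j ≡ decrement μ i j
      tail-profile a p e₀ j with j ≟ i
      ... | yes refl = trans (ℕₚ.suc-injective (trans (sym (levelCount-≡ a j e₀)) (trans (p j) eᵢ))) (cong (_∸ 1) (sym eᵢ))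
      ... | no ne = trans (sym (levelCount-≢ a j (λ e → ne (trans (sym e) e₀)))) (p j)
      cons-profile : ∀ a → (∀ j → levelCount a j ≡ decrement μ i j) → ∀ j → levelCount (cons a) j ≡ μ j
      cons-profile a p j = by-level (i ≟ j)
        where
        by-level : Dec (i ≡ j) → levelCount (cons a) j ≡ μ j
        by-level (yes refl) = trans (levelCount-≡ (cons a) i refl) (trans (cong suc (p i)) (decrement-≡ μ i eᵢ))
        by-level (no ne) = trans (levelCount-≢ (cons a) j ne) (trans (p j) (sym (decrement-≢ μ i j (ne ∘ sym))))

-- Rooted trees and parent maps

does-true⁻ : {A : Set} (A? : Dec A) → does A? ≡ true → A
does-true⁻ (yes a) _ = a

true-iff⇒≡ : {b c : Bool} → (b ≡ true → c ≡ true) → (c ≡ true → b ≡ true) → b ≡ c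
true-iff⇒≡ {true} f _ = sym (f refl)
true-iff⇒≡ {false} {false} _ _ = refl
true-iff⇒≡ {false} {true} _ g = g refl

module _ {n : ℕ} where
  private V = Fin n

  -- A finite path along `h` that runs out at `nothing`. Starting from a `Maybe V` lets the path
  -- begin at a prospective value of `h` as well as at a vertex.
  data Ends (h : V → Maybe V) : Maybe V → Set where
    end : Ends h nothing
    go  : ∀ {x} → Ends h (h x) → Ends h (just x)

  Acyclic : (V → Maybe V) → Set
  Acyclic h = ∀ x → Ends h (just x)

  Ends-cong : ∀ {h h'} → h ≗ h' → ∀ {α} → Ends h α → Ends h' α
  Ends-cong e end = end
  Ends-cong e (go {x} p) = go (subst (Ends _) (e x) (Ends-cong e p))

  depth : ∀ {h α} → Ends h α → ℕ
  depth end = 0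
  depth (go p) = suc (depth p)

  depth-unique : ∀ {h α} (p q : Ends h α) → depth p ≡ depth q
  depth-unique end end = refl
  depth-unique (go p) (go q) = cong suc (depth-unique p q)

  -- The measure behind all later exclusions of cycles. It is well defined on vertices because two
  -- derivations of `Ends` have the same length.
  depth-parent : ∀ {h} (acyc : Acyclic h) {x y} → h x ≡ just y → depth (acyc x) ≡ suc (depth (acyc y))
  depth-parent {h} acyc {x} {y} e with acyc x
  ... | go p = cong suc (at-parent p e)
    where
    at-parent : ∀ {α} (p : Ends h α) → α ≡ just y → depth p ≡ depth (acyc y)
    at-parent p refl = depth-unique p (acyc y)

  Link : (V → Maybe V) → V → V → Set
  Link g u v = g u ≡ just v ⊎ g v ≡ just u

  Link? : ∀ g u v → Dec (Link g u v)
  Link? g u v = Maybe-≡-dec Finₚ._≟_ (g u) (just v) ⊎-dec Maybe-≡-dec Finₚ._≟_ (g v) (just u)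

  RootAt : (V → Maybe V) → V → Set
  RootAt g ρ = g ρ ≡ nothing × (∀ x → g x ≡ nothing → x ≡ ρ)

  record Represents (E : V → V → Bool) (ρ : V) (g : V → Maybe V) : Set where
    field
      edge⇒link : ∀ {u v} → Adj E u v → Link g u v
      link⇒edge : ∀ {u v} → Link g u v → Adj E u v
      rootAt    : RootAt g ρ
      acyclic   : Acyclic g

  open Represents

  -- By induction along g towards the root: if w is the g-parent of v, the edge vw is
  -- a g'-link, and it cannot point from w to v because g and g' agree at w.
  Represents-unique : ∀ {E ρ g g'} → Represents E ρ g → Represents E ρ g' → g ≗ g'
  Represents-unique {E} {ρ} {g} {g'} r r' v = parents (acyclic r v)
    where
    at-root : ∀ v → g v ≡ nothing → g v ≡ g' v
    at-root v e = trans e (sym (subst (λ x → g' x ≡ nothing) (sym (proj₂ (rootAt r) v e)) (proj₁ (rootAt r'))))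
    parents : ∀ {v} → Ends g (just v) → g v ≡ g' v
    parents {v} (go p) with g v in e
    ... | nothing = trans (sym e) (at-root v e)
    ... | just w with edge⇒link r' (link⇒edge r (inj₁ e))
    ...   | inj₁ e' = sym e'
    ...   | inj₂ e' = ⊥-elim (ℕₚ.<-asym {depth (acyclic r v)} {depth (acyclic r w)}
              (ℕₚ.≤-reflexive (sym (depth-parent (acyclic r) (trans (parents p) e'))))
              (ℕₚ.≤-reflexive (sym (depth-parent (acyclic r) e))))

  Represents-resp : ∀ {E E' ρ g} → (∀ u v → E u v ≡ E' u v) → Represents E ρ g → Represents E' ρ g
  Represents-resp e r = record
    { edge⇒link = λ {u} {v} p → edge⇒link r (trans (e u v) p)
    ; link⇒edge = λ {u} {v} l → trans (sym (e u v)) (link⇒edge r l)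
    ; rootAt = rootAt r ; acyclic = acyclic r }

  -- Both vertices climb to the root, and the second climb is reversed.
  link-connected : ∀ {g ρ} → RootAt g ρ → Acyclic g → ∀ u v → Star (Link g) u v
  link-connected {g} {ρ} (_ , only) acyc u v = to-root u ◅◅ Star.reverse Sum.swap (to-root v)
    where
    climb : ∀ {α} → Ends g α → ∀ x → g x ≡ α → Star (Link g) x ρ
    climb end x e with refl ← only x e = ε
    climb (go {y} p) x e = inj₁ e ◅ climb p y refl
    to-root : ∀ x → Star (Link g) x ρ
    to-root x with go p ← acyc x = climb p x refl

  -- A walk that does not backtrack cannot turn from moving away from the root to moving
  -- towards it.  So a cycle is monotone, which depth forbids, or it leaves and enters its
  -- base point along the same edge, the one to the parent of the base point.
  module _ {g : V → Maybe V} (acyc : Acyclic g) {R : V → V → Set} (R⇒Link : ∀ {u v} → R u v → Link g u v) where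
    private
      d : V → ℕ
      d x = depth (acyc x)
      descends : ∀ {u v} → g u ≡ just v → d v < d u
      descends e = ℕₚ.≤-reflexive (sym (depth-parent acyc e))

    -- Here `v` was entered from its parent `u`. Going back to `u` is excluded by uniqueness, or by
    -- `u ≢ x` if the walk closes at once; hence every step leads to a child. The last hypothesis is
    -- restricted to empty `zs` because `u` may be the base point `x` itself when the walk has just
    -- started.
    keeps-descending : ∀ {x u v} zs → g v ≡ just u → Linked R (v ∷ zs ++ [ x ]) →
      Unique (u ∷ v ∷ zs) → All (x ≢_) (v ∷ zs) → (zs ≡ [] → u ≢ x) →
      (d v < d x) × (∃ λ y → y ∈ (v ∷ zs) × g x ≡ just y)
    keeps-descending {v = v} [] e (l ∷ _) _ _ u≢x with R⇒Link l
    ... | inj₁ e' = ⊥-elim (u≢x refl (just-injective (trans (sym e) e')))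
    ... | inj₂ e' = descends e' , v , here refl , e'
    keeps-descending (w ∷ zs) e (l ∷ ls) ((_ ∷ u≢w ∷ _) ∷ uniq) (x≢v ∷ x≢) _ with R⇒Link l
    ... | inj₁ e' = ⊥-elim (u≢w (just-injective (trans (sym e) e')))
    ... | inj₂ e' with keeps-descending zs e' ls uniq x≢ (λ _ v≡x → x≢v (sym v≡x))
    ...   | lt , y , m , ey = ℕₚ.<-trans (descends e') lt , y , there m , ey

    ascends-or-turns : ∀ {x} v w zs → Linked R (v ∷ w ∷ zs ++ [ x ]) → Unique (v ∷ w ∷ zs) → All (x ≢_) (v ∷ w ∷ zs) →
      (d x < d v) ⊎ (∃ λ y → y ∈ (w ∷ zs) × g x ≡ just y)
    ascends-or-turns v w zs (l ∷ ls) uniq (x≢v ∷ x≢) with R⇒Link l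
    ... | inj₂ e = inj₂ (proj₂ (keeps-descending zs e ls uniq x≢ (λ _ v≡x → x≢v (sym v≡x))))
    ascends-or-turns v w [] (l ∷ l' ∷ _) _ _ | inj₁ e with R⇒Link l'
    ... | inj₁ e' = inj₁ (ℕₚ.<-trans (descends e') (descends e))
    ... | inj₂ e' = inj₂ (w , here refl , e')
    ascends-or-turns v w (w' ∷ zs) (l ∷ ls) (_ ∷ uniq) (_ ∷ x≢) | inj₁ e with ascends-or-turns w w' zs ls uniq x≢
    ... | inj₁ lt = inj₁ (ℕₚ.<-trans lt (descends e))
    ... | inj₂ (y , m , ey) = inj₂ (y , there m , ey)

    no-cycle : ∀ x ys → 2 ℕ.≤ length ys → Unique (x ∷ ys) → Linked R (x ∷ ys ++ [ x ]) → ⊥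
    no-cycle x (_ ∷ []) (s≤s ())
    no-cycle x (y ∷ z ∷ zs) _ uniq@(x≢ ∷ y≢ ∷ _) (l ∷ ls) with R⇒Link l
    ... | inj₂ e = ℕₚ.<-asym (descends e) (proj₁ (keeps-descending (z ∷ zs) e ls uniq x≢ (λ ())))
    ... | inj₁ e with ascends-or-turns y z zs ls (y≢ ∷ AllPairs.tail (AllPairs.tail uniq)) x≢
    ...   | inj₁ lt = ℕₚ.<-asym (descends e) lt
    ...   | inj₂ (y' , m , e') = All.lookup y≢ m (just-injective (trans (sym e) e'))

  edgesOf : (V → Maybe V) → V → V → Bool
  edgesOf g u v = does (Link? g u v)

  edgesOf-represents : ∀ {g ρ} → RootAt g ρ → Acyclic g → Represents (edgesOf g) ρ g
  edgesOf-represents {g} root acyc = record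
    { edge⇒link = λ {u} {v} → does-true⁻ (Link? g u v)
    ; link⇒edge = λ {u} {v} → dec-true (Link? g u v)
    ; rootAt = root ; acyclic = acyc }

  Represents⇒IsTree : ∀ {E ρ g} → Represents E ρ g → IsTree E
  Represents⇒IsTree {E} {ρ} {g} r =
      (λ u v → true-iff⇒≡ flip-edge flip-edge)
    , irreflexive
    , (λ u v → Star.map (link⇒edge r) (link-connected (rootAt r) (acyclic r) u v))
    , (λ (x , ys , two , uniq , linked) → no-cycle (acyclic r) (edge⇒link r) x ys two uniq linked)
    where
    flip-edge : ∀ {u v} → Adj E u v → Adj E v u
    flip-edge p = link⇒edge r (Sum.swap (edge⇒link r p))
    no-loop : ∀ {u} → g u ≡ just u → ⊥
    no-loop e = ℕₚ.1+n≢n (sym (depth-parent (acyclic r) e))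
    irreflexive : ∀ u → E u u ≡ false
    irreflexive u with E u u in e
    ... | false = refl
    ... | true = ⊥-elim (Sum.[ no-loop , no-loop ] (edge⇒link r e))

  -- The parent map of a tree, from shortest walks to the root

  data Path (R : V → V → Set) : V → V → List V → Set where
    stop : ∀ v → Path R v v (v ∷ [])
    _∷_ : ∀ {u w v l} → R u w → Path R w v l → Path R u v (u ∷ l)

  Path-from : ∀ {R u v w l} → u ∈ l → Path R w v l → Unique l → ∃ λ l' → Path R u v l' × Unique l'
  Path-from (here refl) p@(stop _) uniq = _ , p , uniq
  Path-from (here refl) p@(_ ∷ _) uniq = _ , p , uniq
  Path-from (there m) (_ ∷ p) (_ ∷ uniq) = Path-from m p uniq

  -- If the new first vertex already occurs on the erased remainder, the path is restarted at that
  -- occurrence.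
  loop-erase : ∀ {R u v} → Star R u v → ∃ λ l → Path R u v l × Unique l
  loop-erase {v = v} ε = _ , stop v , [] ∷ []
  loop-erase {u = u} (r ◅ rs) with loop-erase rs
  ... | l , p , uniq with Any.any? (u Finₚ.≟_) l
  ...   | yes m = Path-from m p uniq
  ...   | no u∉l = _ , r ∷ p , ¬Any⇒All¬ l u∉l ∷ uniq

  close-path : ∀ {R u v x l} → Path R u v l → R v x → Linked R (l ++ [ x ])
  close-path (stop _) r = r ∷ [-]
  close-path (r ∷ stop _) r' = r ∷ r' ∷ [-]
  close-path (r ∷ p@(_ ∷ _)) r' = r ∷ close-path p r'

  module _ {E : V → V → Bool} (tree : IsTree E) (ρ : V) where
    private
      symmetric = proj₁ tree
      irreflexive = proj₁ (proj₂ tree)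
      connected = proj₁ (proj₂ (proj₂ tree))
      no-cycles = proj₂ (proj₂ (proj₂ tree))

      Walk : ℕ → V → Set
      Walk zero v = v ≡ ρ
      Walk (suc k) v = ∃ λ w → Adj E v w × Walk k w

      Walk? : ∀ k v → Dec (Walk k v)
      Walk? zero v = v Finₚ.≟ ρ
      Walk? (suc k) v = Finₚ.any? λ w → (E v w Data.Bool.≟ true) ×-dec Walk? k w

      Distance : V → Set
      Distance v = ∃ λ k → Walk k v × (∀ j → Walk j v → k ℕ.≤ j)

      walk : ∀ {v} → Star (Adj E) v ρ → ∃ λ k → Walk k v
      walk ε = 0 , refl
      walk (e ◅ es) with walk es
      ... | k , w = suc k , _ , e , w

      distance : ∀ v → Distance v
      distance v = least (proj₁ some-walk) 0
        (subst (λ k → Walk k v) (sym (ℕₚ.+-identityʳ _)) (proj₂ some-walk)) (λ _ ())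
        where
        some-walk = walk (connected v ρ)
        -- Upward search for the shortest length. The known walk has length `k + j` throughout, so
        -- when the fuel `k` is exhausted it is itself a shortest one.
        least : ∀ k j → Walk (k ℕ.+ j) v → (∀ i → i < j → ¬ Walk i v) → Distance v
        least zero j w below = j , w , λ i wi → ℕₚ.≮⇒≥ (λ i<j → below i i<j wi)
        least (suc k) j w below with Walk? j v
        ... | yes wj = j , wj , λ i wi → ℕₚ.≮⇒≥ (λ i<j → below i i<j wi)
        ... | no ¬wj = least k (suc j) (subst (λ i → Walk i v) (sym (ℕₚ.+-suc k j)) w) below'
          where
          below' : ∀ i → i < suc j → ¬ Walk i v
          below' i i<1+j wi with ℕₚ.m<1+n⇒m<n∨m≡n i<1+j
          ... | inj₁ i<j = below i i<j wi
          ... | inj₂ refl = ¬wj wi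

      -- The first step of a shortest walk to `ρ`.
      parent : ∀ {v} → Distance v → Maybe V
      parent (zero , _) = nothing
      parent (suc _ , (w , _) , _) = just w

      g : V → Maybe V
      g v = parent (distance v)

      -- Induction on a bound for the distance: the rest of a shortest walk from `v` is a walk from
      -- its parent, whose distance is therefore smaller.
      g-ends : ∀ k v → proj₁ (distance v) ℕ.≤ k → Ends g (just v)
      parent-ends : ∀ k {v} (D : Distance v) → proj₁ D ℕ.≤ k → Ends g (parent D)
      g-ends k v le = go (parent-ends k (distance v) le)
      parent-ends k (zero , _) _ = end
      parent-ends (suc k) (suc j , (w , _ , walk-w) , _) (s≤s le) =
        g-ends k w (ℕₚ.≤-trans (proj₂ (proj₂ (distance w)) j walk-w) le)

      g-rootAt : RootAt g ρ
      g-rootAt = root (distance ρ) , (λ x → only (distance x))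
        where
        root : (D : Distance ρ) → parent D ≡ nothing
        root (zero , _) = refl
        root (suc k , _ , min) with () ← min 0 refl
        only : ∀ {x} (D : Distance x) → parent D ≡ nothing → x ≡ ρ
        only (zero , x≡ρ , _) _ = x≡ρ

      parent-edge : ∀ {u v} → g u ≡ just v → Adj E u v
      parent-edge {u} = along (distance u)
        where
        along : ∀ {v} (D : Distance u) → parent D ≡ just v → Adj E u v
        along (suc _ , (w , e , _) , _) refl = e

      g-acyclic : Acyclic g
      g-acyclic v = g-ends _ v ℕₚ.≤-refl

      flip-edge : ∀ {u v} → Adj E u v → Adj E v u
      flip-edge {u} {v} e = trans (sym (symmetric u v)) e

      g-link⇒edge : ∀ {u v} → Link g u v → Adj E u v
      g-link⇒edge (inj₁ e) = parent-edge e
      g-link⇒edge (inj₂ e) = flip-edge (parent-edge e)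

      Path-map : ∀ {R R' : V → V → Set} → (∀ {u v} → R u v → R' u v) → ∀ {u v l} → Path R u v l → Path R' u v l
      Path-map f (stop v) = stop v
      Path-map f (r ∷ p) = f r ∷ Path-map f p

      -- The edge from `v` back to `u` closes the path. A path with one vertex would make this edge
      -- a loop, and a path with two would be the link that is denied, so at least three vertices
      -- remain.
      cycle-through : ∀ {u v l} → Path (Link g) u v l → Unique l → Adj E v u → ¬ Link g u v → HasCycle E
      cycle-through (stop v) _ e _ with () ← trans (sym (irreflexive v)) e
      cycle-through (r ∷ stop v) _ _ ¬r = ⊥-elim (¬r r)
      -- The last two clauses are split only to expose three vertices in the list.
      cycle-through {u} p@(_ ∷ _ ∷ stop v) uniq e _ = u , _ , s≤s (s≤s z≤n) , uniq , close-path (Path-map g-link⇒edge p) e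
      cycle-through {u} p@(_ ∷ _ ∷ _ ∷ _) uniq e _ = u , _ , s≤s (s≤s z≤n) , uniq , close-path (Path-map g-link⇒edge p) e

    -- Links of `g` are edges by construction. An edge that is not a link would form a cycle with
    -- the loop-erased path of links between its ends.
    tree-represented : ∃ λ g → Represents E ρ g
    tree-represented = g , record
      { edge⇒link = edge⇒link' ; link⇒edge = g-link⇒edge ; rootAt = g-rootAt ; acyclic = g-acyclic }
      where
      edge⇒link' : ∀ {u v} → Adj E u v → Link g u v
      edge⇒link' {u} {v} e with Link? g u v
      ... | yes l = l
      ... | no ¬l with loop-erase (link-connected g-rootAt g-acyclic u v)
      ...   | _ , p , uniq = ⊥-elim (no-cycles (cycle-through p uniq (flip-edge e) ¬l))

-- Cutting a parent map at two vertices of the same level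

open Represents

module _ {n : ℕ} where
  private V = Fin n

  RootedGraphSetoid : Setoid 0ℓ 0ℓ
  RootedGraphSetoid = record
    { Carrier = (V → V → Bool) × V
    ; _≈_ = λ (E , ρ) (E' , ρ') → (∀ u v → E u v ≡ E' u v) × ρ ≡ ρ'
    ; isEquivalence = record
      { refl = (λ _ _ → refl) , refl
      ; sym = λ (e , r) → (λ u v → sym (e u v)) , sym r
      ; trans = λ (e , r) (e' , r') → (λ u v → trans (e u v) (e' u v)) , trans r r' } }

  ParentMapSetoid : Setoid 0ℓ 0ℓ
  ParentMapSetoid = V →-setoid Maybe V

  module _ (a : V → ℤ) where

    Fits : ℤ → Maybe V → Set
    Fits i nothing = i ≡ + 0
    Fits i (just w) = ∣ i - a w ∣ ≡ 1

    Embedded : (V → V → Bool) × V → Set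
    Embedded (E , ρ) = IsTree E × a ρ ≡ + 0 × (∀ u v → Adj E u v → ∣ a u - a v ∣ ≡ 1)

    Fitting : (V → Maybe V) → Set
    Fitting g = (∀ x → Fits (a x) (g x)) × ∃ (RootAt g)

    -- A tree is oriented towards its root, and a parent map forgets its orientation. The round
    -- trips are identities because a rooted graph has at most one representing map and a map
    -- determines the edges of the graph it represents.
    trees↔parentMaps : Inverse (Sub RootedGraphSetoid Embedded)
                               (Sub ParentMapSetoid (λ g → Fitting g × Acyclic g))
    trees↔parentMaps = mkInverse
      (λ ((E , ρ) , p) → g p , ((fits p (rep p)) , ρ , rootAt (rep p)) , acyclic (rep p))
      (λ (g , (fits , ρ , root) , acyc) →
        (edgesOf g , ρ) , Represents⇒IsTree (edgesOf-represents root acyc) , level-root fits ρ root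
        , λ u v e → adjacent fits (edge⇒link (edgesOf-represents root acyc) e))
      (λ { {(_ , ρ) , p} {(_ , .ρ) , p'} (e , refl) → Represents-unique (Represents-resp e (rep p)) (rep p') })
      (λ { {g , (_ , ρ , root) , acyc} {g' , (_ , ρ' , root') , acyc'} e →
           same-edges (edgesOf-represents root acyc) (edgesOf-represents root' acyc') e
         , proj₂ root' ρ (trans (sym (e ρ)) (proj₁ root)) })
      (λ { (g , (fits , ρ , root) , acyc) → Represents-unique
           (proj₂ (tree-represented (Represents⇒IsTree (edgesOf-represents root acyc)) ρ)) (edgesOf-represents root acyc) })
      (λ { ((E , ρ) , p) → same-edges (edgesOf-represents (rootAt (rep p)) (acyclic (rep p))) (rep p) (λ _ → refl) , refl })
      where
      g : ∀ {Eρ} → Embedded Eρ → V → Maybe V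
      g {E , ρ} (tree , _) = proj₁ (tree-represented tree ρ)
      rep : ∀ {Eρ} (p : Embedded Eρ) → Represents (proj₁ Eρ) (proj₂ Eρ) (g p)
      rep {E , ρ} (tree , _) = proj₂ (tree-represented tree ρ)
      fits : ∀ {E ρ} (p : Embedded (E , ρ)) {g} → Represents E ρ g → ∀ x → Fits (a x) (g x)
      fits (_ , aρ , step) {g} r x with g x in e
      ... | nothing = trans (cong a (proj₂ (rootAt r) x e)) aρ
      ... | just w = step x w (link⇒edge r (inj₁ e))
      level-root : ∀ {g} → (∀ x → Fits (a x) (g x)) → ∀ ρ → RootAt g ρ → a ρ ≡ + 0
      level-root fits ρ (e , _) = subst (Fits (a ρ)) e (fits ρ)
      adjacent : ∀ {g} → (∀ x → Fits (a x) (g x)) → ∀ {u v} → Link g u v → ∣ a u - a v ∣ ≡ 1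
      adjacent fits {u} {v} (inj₁ e) = subst (Fits (a u)) e (fits u)
      adjacent fits {u} {v} (inj₂ e) = trans (ℤₚ.∣i-j∣≡∣j-i∣ (a u) (a v)) (subst (Fits (a v)) e (fits v))
      link-cong : ∀ {g g' : V → Maybe V} → g ≗ g' → ∀ {u v} → Link g u v → Link g' u v
      link-cong e {u} {v} = Sum.map (trans (sym (e u))) (trans (sym (e v)))
      same-edges : ∀ {E E' ρ ρ' g g'} → Represents E ρ g → Represents E' ρ' g' → g ≗ g' → ∀ u v → E u v ≡ E' u v
      same-edges r r' e u v = true-iff⇒≡
        (λ p → link⇒edge r' (link-cong e (edge⇒link r p)))
        (λ p → link⇒edge r (link-cong (sym ∘ e) (edge⇒link r' p)))

  -- With `u` and `v` terminal in `h`, reaching `u` is type U, reaching `v` is type V, and an ending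
  -- path that reaches neither is type R.
  data Reach (h : V → Maybe V) : Maybe V → V → Set where
    here  : ∀ {t} → Reach h (just t) t
    there : ∀ {x t} → Reach h (h x) t → Reach h (just x) t

  Reach-cong : ∀ {h h'} → h ≗ h' → ∀ {α t} → Reach h α t → Reach h' α t
  Reach-cong e here = here
  Reach-cong e (there {x} r) = there (subst (λ α → Reach _ α _) (e x) (Reach-cong e r))

  Reach? : ∀ {h α} → Ends h α → ∀ t → Dec (Reach h α t)
  Reach? end t = no λ ()
  Reach? (go {x} p) t with x Finₚ.≟ t
  ... | yes refl = yes here
  ... | no x≢t with Reach? p t
  ...   | yes r = yes (there r)
  ...   | no ¬r = no λ { here → x≢t refl ; (there r) → ¬r r }

  Acyclic⇒Ends : ∀ {h : V → Maybe V} → Acyclic h → ∀ α → Ends h α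
  Acyclic⇒Ends acyc nothing = end
  Acyclic⇒Ends acyc (just x) = acyc x

  Terminal : (V → Maybe V) → V → Set
  Terminal h t = h t ≡ nothing

  ¬Reach-past : ∀ {h t t'} → Terminal h t → ¬ Reach h (h t) t'
  ¬Reach-past {h} {t} {t'} e r with () ← subst (λ α → Reach h α t') e r

  Reach-terminal-unique : ∀ {h α t t'} → Terminal h t → Terminal h t' → Reach h α t → Reach h α t' → t ≡ t'
  Reach-terminal-unique _ _ here here = refl
  Reach-terminal-unique et et' here (there r) = ⊥-elim (¬Reach-past et r)
  Reach-terminal-unique et et' (there r) here = ⊥-elim (¬Reach-past et' r)
  Reach-terminal-unique et et' (there r) (there r') = Reach-terminal-unique et et' r r'

  -- For `α` at `u` and `β` at `v`, the pairs of types that survive are (R,R), (R,U) and (V,R).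
  Safe : (V → Maybe V) → (u v : V) → Maybe V → Maybe V → Set
  Safe h u v α β = ¬ Reach h α u × ¬ Reach h β v × ¬ (Reach h α v × Reach h β u)

  module Cut {h f : V → Maybe V} {u v : V} (hu : Terminal h u) (hv : Terminal h v)
             (agree : ∀ x → x ≢ u → x ≢ v → f x ≡ h x) where

    private
      inner : ∀ {x t} → Reach h (h x) t → f x ≡ h x
      inner {x} r = agree x (λ { refl → ¬Reach-past hu r }) (λ { refl → ¬Reach-past hv r })

    Ends-cut : ∀ {α} → Ends f α → Ends h α
    Ends-cut end = end
    Ends-cut (go {x} p) with x Finₚ.≟ u | x Finₚ.≟ v
    ... | yes refl | _ = go (subst (Ends h) (sym hu) end)
    ... | no _ | yes refl = go (subst (Ends h) (sym hv) end)
    ... | no x≢u | no x≢v = go (subst (Ends h) (agree x x≢u x≢v) (Ends-cut p))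

    Ends-uncut : Ends f (just u) → Ends f (just v) → ∀ {α} → Ends h α → Ends f α
    Ends-uncut pu pv end = end
    Ends-uncut pu pv (go {x} p) with x Finₚ.≟ u | x Finₚ.≟ v
    ... | yes refl | _ = pu
    ... | no _ | yes refl = pv
    ... | no x≢u | no x≢v = go (subst (Ends f) (sym (agree x x≢u x≢v)) (Ends-uncut pu pv p))

    Ends-avoiding : ∀ {α} → Ends h α → ¬ Reach h α u → ¬ Reach h α v → Ends f α
    Ends-avoiding end _ _ = end
    Ends-avoiding (go {x} p) ¬u ¬v =
      go (subst (Ends f) (sym (agree x (λ { refl → ¬u here }) (λ { refl → ¬v here })))
        (Ends-avoiding p (¬u ∘ there) (¬v ∘ there)))

    Ends-following : ∀ {α t} → Reach h α t → Ends f (just t) → Ends f α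
    Ends-following here p = p
    Ends-following (there r) p = go (subst (Ends f) (sym (inner r)) (Ends-following r p))

    depth-Reach : (acyc : Acyclic f) → ∀ {α x t} → f x ≡ α → Reach h α t → depth (acyc t) < depth (acyc x)
    depth-Reach acyc e here = ℕₚ.≤-reflexive (sym (depth-parent acyc e))
    depth-Reach acyc e (there r) =
      ℕₚ.<-trans (depth-Reach acyc (inner r) r) (ℕₚ.≤-reflexive (sym (depth-parent acyc e)))

    -- A forbidden pair of types closes a cycle of `f` through `u`, `v` or both, and `depth` in `f`
    -- would decrease all the way around it.
    Acyclic⇒Safe : Acyclic f → Acyclic h × Safe h u v (f u) (f v)
    Acyclic⇒Safe acyc = (λ x → Ends-cut (acyc x))
      , (λ r → ℕₚ.<-irrefl refl (depth-Reach acyc refl r))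
      , (λ r → ℕₚ.<-irrefl refl (depth-Reach acyc refl r))
      , (λ (r , r') → ℕₚ.<-asym (depth-Reach acyc refl r) (depth-Reach acyc refl r'))

    -- It suffices that `f` ends from `u` and from `v`. One of them has a value of type R and ends
    -- directly; the other ends directly too or runs into the first.
    Safe⇒Acyclic : Acyclic h → Safe h u v (f u) (f v) → Acyclic f
    Safe⇒Acyclic acyc (¬uu , ¬vv , ¬uvu) x with Reach? (Acyclic⇒Ends {h} acyc (f u)) v
    ... | yes uv = Ends-uncut (go (Ends-following uv pv)) pv (acyc x)
      where
      pv : Ends f (just v)
      pv = go (Ends-avoiding (Acyclic⇒Ends {h} acyc (f v)) (λ vu → ¬uvu (uv , vu)) ¬vv)
    ... | no ¬uv = Ends-uncut pu pv (acyc x)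
      where
      pu : Ends f (just u)
      pu = go (Ends-avoiding (Acyclic⇒Ends {h} acyc (f u)) ¬uu ¬uv)
      pv : Ends f (just v)
      pv with Reach? (Acyclic⇒Ends {h} acyc (f v)) u
      ... | yes vu = go (Ends-following vu pu)
      ... | no ¬vu = go (Ends-avoiding (Acyclic⇒Ends {h} acyc (f v)) ¬vu ¬vv)

  -- Exchanging the values at two vertices

  transpose-i : ∀ (i j : V) → transpose i j i ≡ j
  transpose-i i j rewrite dec-true (i Finₚ.≟ i) refl = refl

  transpose-j : ∀ (i j : V) → transpose i j j ≡ i
  transpose-j i j with j Finₚ.≟ i
  ... | yes j≡i = j≡i
  ... | no _ rewrite dec-true (j Finₚ.≟ j) refl = refl

  transpose-other : ∀ (i j : V) {k} → k ≢ i → k ≢ j → transpose i j k ≡ k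
  transpose-other i j {k} k≢i k≢j rewrite dec-false (k Finₚ.≟ i) k≢i | dec-false (k Finₚ.≟ j) k≢j = refl

  transpose-involutive : ∀ (i j k : V) → transpose i j (transpose i j k) ≡ k
  transpose-involutive i j k with k Finₚ.≟ i
  ... | yes refl = transpose-j i j
  ... | no k≢i with k Finₚ.≟ j
  ...   | yes refl = transpose-i i j
  ...   | no k≢j = transpose-other i j k≢i k≢j

  -- h g stands for g with u and v made terminal; it ignores the values at u and v, so it
  -- is unaffected by exchanging them.
  module Exchange {u v : V} (u≢v : u ≢ v)
    (h : (V → Maybe V) → V → Maybe V)
    (h-local : ∀ {g g'} → (∀ x → x ≢ u → x ≢ v → g x ≡ g' x) → h g ≗ h g')
    (hu : ∀ g → Terminal (h g) u) (hv : ∀ g → Terminal (h g) v)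
    (Q : (V → Maybe V) → Set) (Q-swap : ∀ {g} → Q g → Q (g ∘ transpose u v)) where

    private
      τ = transpose u v

      -- The decision is computed from a proof of acyclicity and not from `g` alone. It is therefore
      -- an argument, and the lemmas below compare two decisions of equivalent statements.
      swapIf : {X : Set} → Dec X → (V → Maybe V) → V → Maybe V
      swapIf (yes _) g = g ∘ τ
      swapIf (no _) g = g

      swapIf-cong : {X X' : Set} (d : Dec X) (d' : Dec X') → (X → X') → (X' → X) →
        ∀ {g g'} → g ≗ g' → swapIf d g ≗ swapIf d' g'
      swapIf-cong (yes _) (yes _) _ _ e x = e (τ x)
      swapIf-cong (yes p) (no ¬p) f _ e x = ⊥-elim (¬p (f p))
      swapIf-cong (no ¬p) (yes p) _ f e x = ⊥-elim (¬p (f p))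
      swapIf-cong (no _) (no _) _ _ e x = e x

      swapIf-twice : {X X' : Set} (d : Dec X) (d' : Dec X') → (X → X') → (X' → X) →
        ∀ g → swapIf d' (swapIf d g) ≗ g
      swapIf-twice (yes _) (yes _) _ _ g x = cong g (transpose-involutive u v x)
      swapIf-twice (yes p) (no ¬p) f _ g x = ⊥-elim (¬p (f p))
      swapIf-twice (no ¬p) (yes p) _ f g x = ⊥-elim (¬p (f p))
      swapIf-twice (no _) (no _) _ _ g x = refl

      h-cong : ∀ {g g'} → g ≗ g' → h g ≗ h g'
      h-cong e = h-local (λ x _ _ → e x)

      h-swap : ∀ g → h g ≗ h (g ∘ τ)
      h-swap g = h-local (λ x x≢u x≢v → cong g (sym (transpose-other u v x≢u x≢v)))

      h-swapIf : ∀ {X : Set} (d : Dec X) g → h g ≗ h (swapIf d g)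
      h-swapIf (yes _) g = h-swap g
      h-swapIf (no _) g _ = refl

      Reach-swap : ∀ g {α t} → Reach (h g) α t → Reach (h (g ∘ τ)) α t
      Reach-swap g = Reach-cong (h-swap g)

      Reach-swap⁻ : ∀ g {α t} → Reach (h (g ∘ τ)) α t → Reach (h g) α t
      Reach-swap⁻ g = Reach-cong (sym ∘ h-swap g)

      Acyclic-swapIf : ∀ {X : Set} (d : Dec X) g → Acyclic (h g) → Acyclic (h (swapIf d g))
      Acyclic-swapIf d g acyc x = Ends-cong (h-swapIf d g) (acyc x)

      Q-swapIf : ∀ {X : Set} (d : Dec X) g → Q g → Q (swapIf d g)
      Q-swapIf (yes _) g q = Q-swap q
      Q-swapIf (no _) g q = q

      CutAcyclic : (V → Maybe V) → Set
      CutAcyclic g = Q g × Acyclic (h g)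

      reach : ∀ {g} → CutAcyclic g → ∀ x → Dec (Reach (h g) (g x) u)
      reach {g} (_ , acyc) x = Reach? (Acyclic⇒Ends {h g} acyc (g x)) u

      swapIf-cutAcyclic : ∀ {X : Set} (d : Dec X) {g} → CutAcyclic g → CutAcyclic (swapIf d g)
      swapIf-cutAcyclic d {g} (q , acyc) = Q-swapIf d g q , Acyclic-swapIf d g acyc

      -- The value `just v` has type V, so safety leaves only type R for `β`.
      forced-safe : ∀ {g β} → ¬ Reach (h g) β u → ¬ Reach (h g) β v → Safe (h g) u v (just v) β
      forced-safe {g} ¬βu ¬βv =
        (λ { here → u≢v refl ; (there r) → ¬Reach-past (hv g) r }) , ¬βv , (λ (_ , βu) → ¬βu βu)

      -- If `g v` has type U, then `g u` must have type R, and the swap brings it to `v`. Otherwise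
      -- `g v` already has type R.
      forward-safe : ∀ {g} (d : Dec (Reach (h g) (g v) u)) → Safe (h g) u v (g u) (g v) →
        Safe (h (swapIf d g)) u v (just v) (swapIf d g v)
      forward-safe {g} (yes vu) (¬uu , _ , ¬uvu) = forced-safe {g ∘ τ}
        (λ r → ¬uu (Reach-swap⁻ g (subst (λ x → Reach (h (g ∘ τ)) (g x) u) (transpose-j u v) r)))
        (λ r → ¬uvu (Reach-swap⁻ g (subst (λ x → Reach (h (g ∘ τ)) (g x) v) (transpose-j u v) r) , vu))
      forward-safe {g} (no ¬vu) (_ , ¬vv , _) = forced-safe {g} ¬vu ¬vv

      -- Here `g v` has type R and `g u` is arbitrary. Only (U,R) is unsafe, and swapping turns it
      -- into (R,U).
      backward-safe : ∀ {g} (d : Dec (Reach (h g) (g u) u)) → Safe (h g) u v (just v) (g v) →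
        Safe (h (swapIf d g)) u v (swapIf d g u) (swapIf d g v)
      backward-safe {g} (yes uu) (_ , ¬vv , ¬vu) =
          (λ r → ¬vu (here , Reach-swap⁻ g (subst (λ x → Reach (h (g ∘ τ)) (g x) u) (transpose-i u v) r)))
        , (λ r → u≢v (Reach-terminal-unique (hu g) (hv g) uu
                   (Reach-swap⁻ g (subst (λ x → Reach (h (g ∘ τ)) (g x) v) (transpose-j u v) r))))
        , (λ (r , _) → ¬vv (Reach-swap⁻ g (subst (λ x → Reach (h (g ∘ τ)) (g x) v) (transpose-i u v) r)))
      backward-safe {g} (no ¬uu) (_ , ¬vv , ¬vu) = ¬uu , ¬vv , (λ (_ , vu) → ¬vu (here , vu))

      -- The forward map tests the value at `v`, the backward map the value at `u`. Testing the
      -- other vertex after a possible swap gives the same answer as before, so each map undoes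
      -- exactly the swaps of the other.
      reach-swapIf : ∀ {g x y} → τ y ≡ x → (d : Dec (Reach (h g) (g x) u)) →
        ¬ Reach (h g) (g y) u →
        (Reach (h g) (g x) u → Reach (h (swapIf d g)) (swapIf d g y) u) ×
        (Reach (h (swapIf d g)) (swapIf d g y) u → Reach (h g) (g x) u)
      reach-swapIf {g} refl (yes p) _ = Reach-swap g , Reach-swap⁻ g
      reach-swapIf {g} refl (no ¬p) ¬y = (λ p → ⊥-elim (¬p p)) , (λ r → ⊥-elim (¬y r))

    exchange : Inverse
      (Sub ParentMapSetoid (λ g → (Q g × Acyclic (h g)) × Safe (h g) u v (g u) (g v)))
      (Sub ParentMapSetoid (λ g → (Q g × Acyclic (h g)) × Safe (h g) u v (just v) (g v)))
    exchange = mkInverse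
      (λ (g , c , safe) → swapIf (reach c v) g , swapIf-cutAcyclic (reach c v) c , forward-safe (reach c v) safe)
      (λ (g , c , safe) → swapIf (reach c u) g , swapIf-cutAcyclic (reach c u) c , backward-safe (reach c u) safe)
      (λ { {g , c , _} {g' , c' , _} e → swapIf-cong (reach c v) (reach c' v) (transport e v) (transport (sym ∘ e) v) e })
      (λ { {g , c , _} {g' , c' , _} e → swapIf-cong (reach c u) (reach c' u) (transport e u) (transport (sym ∘ e) u) e })
      (λ { (g , c , (_ , ¬vv , ¬vu)) →
           let d = reach c u ; iff = reach-swapIf (transpose-j u v) d (λ r → ¬vu (here , r))
           in swapIf-twice d (reach (swapIf-cutAcyclic d c) v) (proj₁ iff) (proj₂ iff) g })
      (λ { (g , c , (¬uu , _ , _)) →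
           let d = reach c v ; iff = reach-swapIf (transpose-i u v) d ¬uu
           in swapIf-twice d (reach (swapIf-cutAcyclic d c) u) (proj₁ iff) (proj₂ iff) g })
      where
      transport : ∀ {g g'} → g ≗ g' → ∀ x → Reach (h g) (g x) u → Reach (h g') (g' x) u
      transport {g} {g'} e x r = subst (λ α → Reach (h g') α u) (e x) (Reach-cong (h-cong e) r)

-- Redirecting vertices to the representative of their level

module _ {n : ℕ} (a : Fin n → ℤ) where
  private V = Fin n

  firstAtLevel : ℤ → V → List V → V
  firstAtLevel i default [] = default
  firstAtLevel i default (x ∷ xs) with a x ≟ i
  ... | yes _ = x
  ... | no _ = firstAtLevel i default xs

  firstAtLevel-level : ∀ i d xs → a d ≡ i → a (firstAtLevel i d xs) ≡ i
  firstAtLevel-level i d [] e = e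
  firstAtLevel-level i d (x ∷ xs) e with a x ≟ i
  ... | yes e' = e'
  ... | no _ = firstAtLevel-level i d xs e

  firstAtLevel-default : ∀ i d d' {x} xs → x ∈ xs → a x ≡ i → firstAtLevel i d xs ≡ firstAtLevel i d' xs
  firstAtLevel-default i d d' (y ∷ xs) m e with a y ≟ i
  ... | yes _ = refl
  firstAtLevel-default i d d' (y ∷ xs) (here refl) e | no ne = ⊥-elim (ne e)
  firstAtLevel-default i d d' (y ∷ xs) (there m) e | no _ = firstAtLevel-default i d d' xs m e

  -- The default is never returned here; it only makes firstAtLevel total.
  rep : V → V
  rep x = firstAtLevel (a x) x (allFin n)

  rep-level : ∀ x → a (rep x) ≡ a x
  rep-level x = firstAtLevel-level (a x) x (allFin n) refl

  rep-cong : ∀ {x y} → a x ≡ a y → rep x ≡ rep y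
  rep-cong {x} {y} e rewrite e = firstAtLevel-default (a y) x y (allFin n) (∈-allFin y) refl

  rep-idem : ∀ x → rep (rep x) ≡ rep x
  rep-idem x = rep-cong (rep-level x)

  force : ℕ → (V → Maybe V) → V → Maybe V
  force k g x with rep x Finₚ.≟ x | toℕ x ℕ.<? k
  ... | no _ | yes _ = just (rep x)
  ... | _ | _ = g x

  force-rep : ∀ k g x → rep x ≡ x → force k g x ≡ g x
  force-rep k g x e with rep x Finₚ.≟ x | toℕ x ℕ.<? k
  ... | yes _ | _ = refl
  ... | no ne | _ = ⊥-elim (ne e)

  force-late : ∀ k g x → ¬ toℕ x < k → force k g x ≡ g x
  force-late k g x ¬lt with rep x Finₚ.≟ x | toℕ x ℕ.<? k
  ... | yes _ | _ = refl
  ... | no _ | yes lt = ⊥-elim (¬lt lt)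
  ... | no _ | no _ = refl

  force-early : ∀ k g x → rep x ≢ x → toℕ x < k → force k g x ≡ just (rep x)
  force-early k g x ne lt with rep x Finₚ.≟ x | toℕ x ℕ.<? k
  ... | yes e | _ = ⊥-elim (ne e)
  ... | no _ | yes _ = refl
  ... | no _ | no ¬lt = ⊥-elim (¬lt lt)

  force-cong : ∀ k {g g'} x → g x ≡ g' x → force k g x ≡ force k g' x
  force-cong k x e with rep x Finₚ.≟ x | toℕ x ℕ.<? k
  ... | yes _ | _ = e
  ... | no _ | yes _ = refl
  ... | no _ | no _ = e

  force-suc : ∀ k g x → toℕ x ≢ k → force (suc k) g x ≡ force k g x
  force-suc k g x x≢k = by-case (rep x Finₚ.≟ x) (toℕ x ℕ.<? k)
    where
    by-case : Dec (rep x ≡ x) → Dec (toℕ x < k) → force (suc k) g x ≡ force k g x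
    by-case (yes e) _ = trans (force-rep (suc k) g x e) (sym (force-rep k g x e))
    by-case (no ne) (yes lt) = trans (force-early (suc k) g x ne (ℕₚ.m<n⇒m<1+n lt)) (sym (force-early k g x ne lt))
    by-case (no ne) (no ¬lt) =
      trans (force-late (suc k) g x (λ lt → ¬lt (ℕₚ.≤∧≢⇒< (ℕₚ.≤-pred lt) x≢k))) (sym (force-late k g x ¬lt))

  -- Interpolates between acyclicity of `g` at `k = 0` and acyclicity with every vertex other than a
  -- representative redirected at `k = n`. The overwritten values stay in `g`, restricted only by
  -- `Fitting`.
  Stage : ℕ → (V → Maybe V) → Set
  Stage k g = Fitting a g × Acyclic (force k g)

  cut : V → V → (V → Maybe V) → V → Maybe V
  cut u v f x with x Finₚ.≟ u | x Finₚ.≟ v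
  ... | no _ | no _ = f x
  ... | _ | _ = nothing

  cut-u : ∀ u v f → cut u v f u ≡ nothing
  cut-u u v f with u Finₚ.≟ u | u Finₚ.≟ v
  ... | yes _ | _ = refl
  ... | no ne | _ = ⊥-elim (ne refl)

  cut-v : ∀ u v f → cut u v f v ≡ nothing
  cut-v u v f with v Finₚ.≟ u | v Finₚ.≟ v
  ... | yes _ | _ = refl
  ... | no _ | yes _ = refl
  ... | no _ | no ne = ⊥-elim (ne refl)

  cut-other : ∀ u v f x → x ≢ u → x ≢ v → cut u v f x ≡ f x
  cut-other u v f x x≢u x≢v with x Finₚ.≟ u | x Finₚ.≟ v
  ... | yes e | _ = ⊥-elim (x≢u e)
  ... | no _ | yes e = ⊥-elim (x≢v e)
  ... | no _ | no _ = refl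

  cut-cong : ∀ {u v f f'} → (∀ x → x ≢ u → x ≢ v → f x ≡ f' x) → cut u v f ≗ cut u v f'
  cut-cong {u} {v} e x with x Finₚ.≟ u | x Finₚ.≟ v
  ... | yes _ | _ = refl
  ... | no _ | yes _ = refl
  ... | no x≢u | no x≢v = e x x≢u x≢v

  -- Vertices of one level are subject to the same constraint on their parents; the root moves along
  -- with the transposition.
  Fitting-transpose : ∀ {u v} → a u ≡ a v → ∀ {g} → Fitting a g → Fitting a (g ∘ transpose u v)
  Fitting-transpose {u} {v} au≡av {g} (fits , ρ , gρ , only) =
      (λ x → subst (λ i → Fits a i (g (τ x))) (level x) (fits (τ x)))
    , τ ρ , trans (cong g (transpose-involutive u v ρ)) gρ
    , λ x e → trans (sym (transpose-involutive u v x)) (cong τ (only (τ x) e))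
    where
    τ = transpose u v
    level : ∀ x → a (τ x) ≡ a x
    level x with x Finₚ.≟ u
    ... | yes refl = sym au≡av
    ... | no x≢u with x Finₚ.≟ v
    ...   | yes refl = au≡av
    ...   | no x≢v = refl

  module _ {k : ℕ} (u : V) (u≡k : toℕ u ≡ k) (forced : rep u ≢ u) where
    private
      v = rep u
      h : (V → Maybe V) → V → Maybe V
      h g = cut u v (force k g)
      module Before (g : V → Maybe V) = Cut {h = h g} {f = force k g} {u} {v} (cut-u u v _) (cut-v u v _)
        (λ x x≢u x≢v → sym (cut-other u v _ x x≢u x≢v))
      module After (g : V → Maybe V) = Cut {h = h g} {f = force (suc k) g} {u} {v} (cut-u u v _) (cut-v u v _)
        (λ x x≢u x≢v → trans (force-suc k g x (λ x≡k → x≢u (Finₚ.toℕ-injective (trans x≡k (sym u≡k)))))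
                             (sym (cut-other u v _ x x≢u x≢v)))
      before-u : ∀ g → force k g u ≡ g u
      before-u g = force-late k g u (λ lt → ℕₚ.<⇒≢ lt u≡k)
      after-u : ∀ g → force (suc k) g u ≡ just v
      after-u g = force-early (suc k) g u forced (s≤s (ℕₚ.≤-reflexive u≡k))
      at-v : ∀ j g → force j g v ≡ g v
      at-v j g = force-rep j g v (rep-idem u)

    -- The two forced maps differ only at `u`, so they have the same cut `h g`. Once this cut is
    -- acyclic, the condition before is safety of `g u` and `g v`, the condition after is safety of
    -- `just v` and `g v`, and `exchange` connects them.
    force-one-more : Inverse (Sub ParentMapSetoid (Stage k)) (Sub ParentMapSetoid (Stage (suc k)))
    force-one-more = Compose.inverse (Compose.inverse
      (Sub-resp
        (λ g (fit , acyc) → let (hac , safe) = Before.Acyclic⇒Safe g acyc in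
          (fit , hac) , subst₂ (Safe (h g) u v) (before-u g) (at-v k g) safe)
        (λ g ((fit , hac) , safe) → fit , Before.Safe⇒Acyclic g hac
          (subst₂ (Safe (h g) u v) (sym (before-u g)) (sym (at-v k g)) safe)))
      (Exchange.exchange (forced ∘ sym) h
        (λ e → cut-cong (λ x x≢u x≢v → force-cong k x (e x x≢u x≢v)))
        (λ _ → cut-u u v _) (λ _ → cut-v u v _) (Fitting a) (Fitting-transpose (sym (rep-level u)))))
      (Sub-resp
        (λ g ((fit , hac) , safe) → fit , After.Safe⇒Acyclic g hac
          (subst₂ (Safe (h g) u v) (sym (after-u g)) (sym (at-v (suc k) g)) safe))
        (λ g (fit , acyc) → let (hac , safe) = After.Acyclic⇒Safe g acyc in
          (fit , hac) , subst₂ (Safe (h g) u v) (after-u g) (at-v (suc k) g) safe))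

  Stage-suc : ∀ {k} → k < n → Inverse (Sub ParentMapSetoid (Stage k)) (Sub ParentMapSetoid (Stage (suc k)))
  Stage-suc {k} k<n with rep (fromℕ< k<n) Finₚ.≟ fromℕ< k<n
  ... | no forced = force-one-more (fromℕ< k<n) (Finₚ.toℕ-fromℕ< k<n) forced
  ... | yes is-rep = Sub-resp
    (λ g (fit , acyc) → fit , λ x → Ends-cong (sym ∘ same g) (acyc x))
    (λ g (fit , acyc) → fit , λ x → Ends-cong (same g) (acyc x))
    where
    u = fromℕ< k<n
    same : ∀ g → force (suc k) g ≗ force k g
    same g x with x Finₚ.≟ u
    ... | yes refl = trans (force-rep (suc k) g x is-rep) (sym (force-rep k g x is-rep))
    ... | no x≢u = force-suc k g x (λ x≡k → x≢u (Finₚ.toℕ-injective (trans x≡k (sym (Finₚ.toℕ-fromℕ< k<n)))))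

  Stages : ∀ k → k ℕ.≤ n → Inverse (Sub ParentMapSetoid (λ g → Fitting a g × Acyclic g)) (Sub ParentMapSetoid (Stage k))
  Stages zero _ = Sub-resp
    (λ g (fit , acyc) → fit , λ x → Ends-cong (λ y → sym (force-late 0 g y λ ())) (acyc x))
    (λ g (fit , acyc) → fit , λ x → Ends-cong (λ y → force-late 0 g y λ ()) (acyc x))
  Stages (suc k) k<n = Compose.inverse (Stages k (ℕₚ.<⇒≤ k<n)) (Stage-suc k<n)

-- The redirected parent maps

∣i-j∣≡1⇒ : ∀ i j → ∣ i - j ∣ ≡ 1 → j ≡ i - + 1 ⊎ j ≡ i ℤ.+ + 1
∣i-j∣≡1⇒ i j e = Sum.map solve-for-j solve-for-j (unit (i - j) e)
  where
  difference : ∀ i j → j ≡ i - (i - j)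
  difference = solve-∀
  solve-for-j : ∀ {d} → i - j ≡ d → j ≡ i - d
  solve-for-j eᵈ = trans (difference i j) (cong (i -_) eᵈ)
  unit : ∀ d → ∣ d ∣ ≡ 1 → d ≡ + 1 ⊎ d ≡ -[1+ 0 ]
  unit (+ 1) refl = inj₁ refl
  unit -[1+ 0 ] refl = inj₂ refl

∣i-[i-1]∣≡1 : ∀ i → ∣ i - (i - + 1) ∣ ≡ 1
∣i-[i-1]∣≡1 i = cong ∣_∣ (difference i)
  where
  difference : ∀ i → i - (i - + 1) ≡ + 1
  difference = solve-∀

∣i-[i+1]∣≡1 : ∀ i → ∣ i - (i ℤ.+ + 1) ∣ ≡ 1
∣i-[i+1]∣≡1 i = cong ∣_∣ (difference i)
  where
  difference : ∀ i → i - (i ℤ.+ + 1) ≡ -[1+ 0 ]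
  difference = solve-∀

∣-i-[-j]∣≡∣i-j∣ : ∀ i j → ∣ ℤ.- i - ℤ.- j ∣ ≡ ∣ i - j ∣
∣-i-[-j]∣≡∣i-j∣ i j = trans (cong ∣_∣ (negate i j)) (ℤₚ.∣-i∣≡∣i∣ (i - j))
  where
  negate : ∀ i j → ℤ.- i - ℤ.- j ≡ ℤ.- (i - j)
  negate = solve-∀

product-one-special : {A : Set} (c : A → ℕ) {G F : ℕ} {s : A} {M : List A} → Unique M → s ∈ M →
  c s ≡ G → (∀ {x} → x ∈ M → x ≢ s → c x ≡ F) → product (map c M) ≡ G * F ^ (length M ∸ 1)
product-one-special c {G} {F} {M = s ∷ M} (s∉M ∷ _) (here refl) cs others =
  cong₂ _*_ cs (all-F M (λ m → others (there m) (λ x≡s → All.lookup s∉M m (sym x≡s))))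
  where
  all-F : ∀ M → (∀ {x} → x ∈ M → c x ≡ F) → product (map c M) ≡ F ^ length M
  all-F [] _ = refl
  all-F (x ∷ M) e = cong₂ _*_ (e (here refl)) (all-F M (e ∘ there))
product-one-special c {G} {F} {M = x ∷ y ∷ M} (x∉M ∷ uniq) (there m) cs others = begin
  c x * product (map c (y ∷ M))
    ≡⟨ cong₂ _*_ (others (here refl) (All.lookup x∉M m)) (product-one-special c uniq m cs (others ∘ there)) ⟩
  F * (G * F ^ length M)        ≡⟨ x*[y*z]≡y*[x*z] F G _ ⟩
  G * (F * F ^ length M)        ∎
  where open ≡-Reasoning

module _ {n : ℕ} (a : Fin n → ℤ) where
  private V = Fin n

  Steps : ℤ → Maybe V → Set
  Steps i α = ∃ λ w → α ≡ just w × ∣ i - a w ∣ ≡ 1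

  Descends : ℤ → Maybe V → Set
  Descends (+ 0) α = α ≡ nothing
  Descends +[1+ k ] α = ∃ λ w → α ≡ just w × a w ≡ +[1+ k ] - + 1
  Descends -[1+ k ] α = ∃ λ w → α ≡ just w × a w ≡ -[1+ k ] ℤ.+ + 1

  ChoiceIf : {X : Set} → Dec X → ℤ → Maybe V → Set
  ChoiceIf (yes _) = Descends
  ChoiceIf (no _) = Steps

  Choice : V → Maybe V → Set
  Choice x = ChoiceIf (rep a x Finₚ.≟ x) (a x)

  Choice-rep : ∀ {x} → rep a x ≡ x → Choice x ≡ Descends (a x)
  Choice-rep {x} e with rep a x Finₚ.≟ x
  ... | yes _ = refl
  ... | no ne = ⊥-elim (ne e)

  Choice-other : ∀ {x} → rep a x ≢ x → Choice x ≡ Steps (a x)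
  Choice-other {x} ne with rep a x Finₚ.≟ x
  ... | yes e = ⊥-elim (ne e)
  ... | no _ = refl

  Descends⇒Fits : ∀ i α → Descends i α → Fits a i α
  Descends⇒Fits (+ 0) .nothing refl = refl
  Descends⇒Fits +[1+ k ] .(just w) (w , refl , e) rewrite e = ∣i-[i-1]∣≡1 +[1+ k ]
  Descends⇒Fits -[1+ k ] .(just w) (w , refl , e) rewrite e = ∣i-[i+1]∣≡1 -[1+ k ]

  Choice⇒Fits : ∀ x α → Choice x α → Fits a (a x) α
  Choice⇒Fits x α with rep a x Finₚ.≟ x
  ... | yes _ = Descends⇒Fits (a x) α
  ... | no _ = λ { (w , refl , e) → e }

  force-all : ∀ g {x} → rep a x ≢ x → force a n g x ≡ just (rep a x)
  force-all g {x} ne = force-early a n g x ne (Finₚ.toℕ<n x)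

  ∣-[1+k]+1∣<1+k : ∀ k → ∣ -[1+ k ] ℤ.+ + 1 ∣ < suc k
  ∣-[1+k]+1∣<1+k zero = s≤s z≤n
  ∣-[1+k]+1∣<1+k (suc k) = ℕₚ.≤-refl

  module _ (x₀ : V) (level-x₀ : a x₀ ≡ + 0) where

    -- A redirected vertex moves to its representative without changing level, and a representative
    -- moves closer to abscissa 0. Hence the absolute value of the abscissa bounds the recursion,
    -- with at most one sideways step per level. The root is the representative of level 0, which
    -- `x₀` shows to be occupied.
    Choice⇒Stage : ∀ g → (∀ x → Choice x (g x)) → Stage a n g
    Choice⇒Stage g choice =
      ((λ x → Choice⇒Fits x (g x) (choice x)) , rep a x₀ , root , only) , λ x → ends ∣ a x ∣ x ℕₚ.≤-refl
      where
      at-rep : ∀ {x} → rep a x ≡ x → Descends (a x) (g x)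
      at-rep {x} e = subst (λ P → P (g x)) (Choice-rep e) (choice x)
      root : g (rep a x₀) ≡ nothing
      root = subst (λ i → Descends i (g (rep a x₀))) (trans (rep-level a x₀) level-x₀) (at-rep (rep-idem a x₀))
      only : ∀ x → g x ≡ nothing → x ≡ rep a x₀
      only x e with rep a x Finₚ.≟ x
      ... | yes rx≡x = trans (sym rx≡x) (rep-cong a
              (trans (subst (Fits a (a x)) e (Choice⇒Fits x (g x) (choice x))) (sym level-x₀)))
      ... | no ne with subst (λ P → P (g x)) (Choice-other ne) (choice x)
      ...   | w , e' , _ with () ← trans (sym e) e'
      ends : ∀ k x → ∣ a x ∣ ℕ.≤ k → Ends (force a n g) (just x)
      descent : ∀ k i → ∣ i ∣ ℕ.≤ k → ∀ {α} → Descends i α → Ends (force a n g) α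
      rep-ends : ∀ k x → ∣ a x ∣ ℕ.≤ k → rep a x ≡ x → Ends (force a n g) (just x)
      descent k (+ 0) _ refl = end
      descent (suc k) +[1+ i ] (s≤s le) (w , refl , e) = ends k w (subst (λ j → ∣ j ∣ ℕ.≤ k) (sym e) le)
      descent (suc k) -[1+ i ] (s≤s le) (w , refl , e) =
        ends k w (ℕₚ.≤-trans (subst (λ j → ∣ j ∣ ℕ.≤ i) (sym e) (ℕₚ.≤-pred (∣-[1+k]+1∣<1+k i))) le)
      rep-ends k x le e = go (subst (Ends _) (sym (force-rep a n g x e)) (descent k (a x) le (at-rep e)))
      ends k x le with rep a x Finₚ.≟ x
      ... | yes e = rep-ends k x le e
      ... | no ne = go (subst (Ends _) (sym (force-all g ne))
              (rep-ends k (rep a x) (subst (λ i → ∣ i ∣ ℕ.≤ k) (sym (rep-level a x)) le) (rep-idem a x)))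

  -- If the representative of a level b x > 0 moved away from 0, no path starting at
  -- a level ≥ b x could ever get below that level.
  no-escape : ∀ {f g : V → Maybe V} (b : V → ℤ) {x w} →
    (∀ {y} → rep a y ≡ y → f y ≡ g y) → (∀ {y} → rep a y ≢ y → f y ≡ just (rep a y)) →
    (∀ y → b (rep a y) ≡ b y) → (∀ {y z} → b y ≡ b z → rep a y ≡ rep a z) →
    (∀ {y} → g y ≡ nothing → b y ≡ + 0) → (∀ {y z} → g y ≡ just z → ∣ b y - b z ∣ ≡ 1) →
    + 0 ℤ.< b x → rep a x ≡ x → g x ≡ just w → b w ≡ b x ℤ.+ + 1 → ¬ Acyclic f
  no-escape {f} {g} b {x} {w} f-rep f-other b-rep rep-b b-root b-step bx>0 rx≡x gx≡w bw acyc
    with acyc x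
  ... | go p = trapped p x refl ℤₚ.≤-refl
    where
    step-up : ∀ {y z} → b z ≡ b y ℤ.+ + 1 → b x ℤ.≤ b y → b x ℤ.≤ b z
    step-up {y} e le = ℤₚ.≤-trans le (subst (b y ℤ.≤_) (sym e) (ℤₚ.i≤i+j (b y) (+ 1)))
    stays : ∀ {y z} → f y ≡ just z → b x ℤ.≤ b y → b x ℤ.≤ b z
    stays {y} {z} e le with rep a y Finₚ.≟ y
    ... | no ne with refl ← trans (sym e) (f-other ne) = subst (b x ℤ.≤_) (sym (b-rep y)) le
    ... | yes ry≡y with ∣i-j∣≡1⇒ (b y) (b z) (b-step (trans (sym (f-rep ry≡y)) e))
    ...   | inj₂ up = step-up {y} {z} up le
    ...   | inj₁ down with b x ≟ b y
    ...     | no bx≢by = subst (b x ℤ.≤_) (trans (ℤₚ.+-comm -[1+ 0 ] (b y)) (sym down))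
                           (ℤₚ.i<j⇒i≤pred[j] (ℤₚ.≤∧≢⇒< le bx≢by))
    ...     | yes bx≡by with refl ← trans (sym rx≡x) (trans (rep-b bx≡by) ry≡y)
                        with refl ← trans (sym gx≡w) (trans (sym (f-rep ry≡y)) e) = step-up {x} {w} bw le
    trapped : ∀ {α} → Ends f α → ∀ y → f y ≡ α → b x ℤ.≤ b y → ⊥
    trapped end y e le with rep a y Finₚ.≟ y
    ... | no ne with () ← trans (sym e) (f-other ne)
    ... | yes ry≡y = ℤₚ.<⇒≱ bx>0 (subst (b x ℤ.≤_) (b-root (trans (sym (f-rep ry≡y)) e)) le)
    trapped (go {z} p) y e le = trapped p z refl (stays e le)

  -- A path of the forced map can stop only at a representative, and there `g` has no value; so the
  -- root is a representative, namely that of level 0. Any other representative moves by one level,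
  -- and `no-escape` excludes the direction away from 0.
  Stage⇒Choice : ∀ g → Stage a n g → ∀ x → Choice x (g x)
  Stage⇒Choice g ((fits , ρ , gρ , only) , acyc) x = by-rep (rep a x Finₚ.≟ x)
    where
    f = force a n g
    f-rep : ∀ {y} → rep a y ≡ y → f y ≡ g y
    f-rep {y} = force-rep a n g y
    root-level : ∀ {y} → g y ≡ nothing → a y ≡ + 0
    root-level {y} e = subst (Fits a (a y)) e (fits y)
    step : ∀ {y z} → g y ≡ just z → ∣ a y - a z ∣ ≡ 1
    step {y} e = subst (Fits a (a y)) e (fits y)
    last-vertex : ∀ {α} → Ends f α → ∀ y → f y ≡ α → ∃ λ z → f z ≡ nothing
    last-vertex end y e = y , e
    last-vertex (go {z} p) y e = last-vertex p z refl
    last-is-rep : ∀ {z} → f z ≡ nothing → Dec (rep a z ≡ z) → rep a ρ ≡ ρ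
    last-is-rep {z} e (yes rz≡z) = subst (λ y → rep a y ≡ y) (only z (trans (sym (f-rep rz≡z)) e)) rz≡z
    last-is-rep e (no ne) with () ← trans (sym e) (force-all g ne)
    rep-ρ : rep a ρ ≡ ρ
    rep-ρ with go p ← acyc ρ = let (z , e) = last-vertex p ρ refl in last-is-rep e (rep a z Finₚ.≟ z)
    descends : ∀ i → a x ≡ i → rep a x ≡ x → ∀ α → g x ≡ α → Descends i α
    descends (+ 0) ax rx≡x α e = trans (sym e) (subst (λ y → g y ≡ nothing) ρ≡x gρ)
      where
      ρ≡x : ρ ≡ x
      ρ≡x = trans (sym rep-ρ) (trans (rep-cong a (trans (root-level gρ) (sym ax))) rx≡x)
    descends +[1+ k ] ax rx≡x nothing e with () ← trans (sym ax) (root-level e)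
    descends +[1+ k ] ax rx≡x (just w) e with ∣i-j∣≡1⇒ +[1+ k ] (a w) (subst (λ i → ∣ i - a w ∣ ≡ 1) ax (step e))
    ... | inj₁ down = w , refl , down
    ... | inj₂ up = ⊥-elim (no-escape a f-rep (force-all g) (rep-level a) (rep-cong a) root-level step
            (subst (+ 0 ℤ.<_) (sym ax) (ℤ.+<+ (s≤s z≤n))) rx≡x e (trans up (cong (ℤ._+ + 1) (sym ax))) acyc)
    descends -[1+ k ] ax rx≡x nothing e with () ← trans (sym ax) (root-level e)
    descends -[1+ k ] ax rx≡x (just w) e with ∣i-j∣≡1⇒ -[1+ k ] (a w) (subst (λ i → ∣ i - a w ∣ ≡ 1) ax (step e))
    ... | inj₂ up = w , refl , up
    -- Negating all abscissas turns a move away from 0 on the negative side into the case already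
    -- excluded.
    ... | inj₁ down = ⊥-elim (no-escape (λ y → ℤ.- a y) f-rep (force-all g) (λ y → cong (λ i → ℤ.- i) (rep-level a y))
            (λ e → rep-cong a (ℤₚ.neg-injective e)) (λ e → cong (λ i → ℤ.- i) (root-level e))
            (λ {y} {z} e → trans (∣-i-[-j]∣≡∣i-j∣ (a y) (a z)) (step e))
            (subst (λ i → + 0 ℤ.< ℤ.- i) (sym ax) (ℤ.+<+ (s≤s z≤n))) rx≡x e
            (trans (cong (λ i → ℤ.- i) down) (trans (negate -[1+ k ]) (cong (λ i → ℤ.- i ℤ.+ + 1) (sym ax)))) acyc)
      where
      negate : ∀ i → ℤ.- (i - + 1) ≡ ℤ.- i ℤ.+ + 1
      negate = solve-∀
    by-rep : Dec (rep a x ≡ x) → Choice x (g x)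
    by-rep (yes rx≡x) = subst (λ P → P (g x)) (sym (Choice-rep rx≡x)) (descends (a x) refl rx≡x (g x) refl)
    by-rep (no ne) with g x in e
    ... | nothing = ⊥-elim (ne (subst (λ y → rep a y ≡ y) (sym (only x e)) rep-ρ))
    ... | just w = subst (λ P → P (just w)) (sym (Choice-other ne)) (w , refl , step e)

  -- The number of choices at each vertex and each level

  stepCount : ℤ → ℕ
  stepCount i = levelCount a (i - + 1) + levelCount a (i ℤ.+ + 1)

  descentCount : ℤ → ℕ
  descentCount (+ 0) = 1
  descentCount +[1+ k ] = levelCount a (+[1+ k ] - + 1)
  descentCount -[1+ k ] = levelCount a (-[1+ k ] ℤ.+ + 1)

  choiceCountIf : {X : Set} → Dec X → ℤ → ℕ
  choiceCountIf (yes _) = descentCount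
  choiceCountIf (no _) = stepCount

  choiceCount : V → ℕ
  choiceCount x = choiceCountIf (rep a x Finₚ.≟ x) (a x)

  level-∈⁻ : ∀ {i w} → w ∈ filter (λ v → a v ≟ i) (allFin n) → a w ≡ i
  level-∈⁻ {i} m = proj₂ (∈-filter⁻ (λ v → a v ≟ i) {xs = allFin n} m)

  level-size : ∀ i → HasSize (Sub (setoid V) (λ w → a w ≡ i)) (levelCount a i)
  level-size i = HasSize-resp (λ _ → level-∈⁻)
    (λ w e → ∈-filter⁺ (λ v → a v ≟ i) (∈-allFin w) e) (HasSize-∈ (filter⁺ (λ v → a v ≟ i) (allFin⁺ n)))

  just-size : {P : V → Set} {N : ℕ} → HasSize (Sub (setoid V) P) N →
    HasSize (Sub (setoid (Maybe V)) (λ α → ∃ λ w → α ≡ just w × P w)) N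
  just-size = Compose.inverse (mkInverse (λ (_ , w , _ , p) → w , p) (λ (w , p) → just w , w , refl , p)
    (λ { {_ , _ , refl , _} {_ , _ , refl , _} e → just-injective e }) (cong just)
    (λ _ → refl) (λ { (_ , _ , refl , _) → refl }))

  descent-size : ∀ i → HasSize (Sub (setoid (Maybe V)) (Descends i)) (descentCount i)
  descent-size (+ 0) = HasSize-1 nothing refl (λ _ → sym)
  descent-size +[1+ k ] = just-size (level-size _)
  descent-size -[1+ k ] = just-size (level-size _)

  step-size : ∀ i → HasSize (Sub (setoid (Maybe V)) (Steps i)) (stepCount i)
  step-size i = just-size (HasSize-resp
    (λ { _ (inj₁ e) → trans (cong (λ j → ∣ i - j ∣) e) (∣i-[i-1]∣≡1 i)
       ; _ (inj₂ e) → trans (cong (λ j → ∣ i - j ∣) e) (∣i-[i+1]∣≡1 i) })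
    (λ w → ∣i-j∣≡1⇒ i (a w))
    (HasSize-⊎ (level-size (i - + 1)) (level-size (i ℤ.+ + 1))
      (λ { refl e e' → apart (trans (sym e) e') })))
    where
    apart : i - + 1 ≢ i ℤ.+ + 1
    apart e with () ← ∙-cancelˡ (AbelianGroup.group ℤₚ.+-0-abelianGroup) i _ _ e

  choice-size : ∀ x → HasSize (Sub (setoid (Maybe V)) (Choice x)) (choiceCount x)
  choice-size x with rep a x Finₚ.≟ x
  ... | yes _ = descent-size (a x)
  ... | no _ = step-size (a x)

  -- After the last stage the conditions at different vertices are independent, so the count is a
  -- product over the vertices.
  trees-size : ∀ x₀ → a x₀ ≡ + 0 → HasSize (Sub RootedGraphSetoid (Embedded a)) (product (tabulate choiceCount))
  trees-size x₀ level-x₀ = Compose.inverse (trees↔parentMaps a) (Compose.inverse (Stages a n ℕₚ.≤-refl)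
    (HasSize-resp (Choice⇒Stage x₀ level-x₀) Stage⇒Choice (HasSize-Π Choice choiceCount choice-size)))

  -- Adding a vertex changes only the factor of its own level.
  product-by-level : ∀ (c : V → ℕ) {L : List ℤ} → Unique L → ∀ xs → (∀ {x} → x ∈ xs → a x ∈ L) →
    product (map c xs) ≡ product (map (λ i → product (map c (filter (λ v → a v ≟ i) xs))) L)
  product-by-level c {L} uniq [] _ = ones L
    where
    ones : ∀ L → 1 ≡ product (map (λ _ → 1) L)
    ones [] = refl
    ones (_ ∷ L) = trans (ones L) (sym (ℕₚ.*-identityˡ _))
  product-by-level c {L} uniq (x ∷ xs) levels = sym (trans
    (product-update {h = c x} uniq (levels (here refl))
      (cong (product ∘ map c) (filter-accept (λ v → a v ≟ a x) refl))
      (λ j j≢ → cong (product ∘ map c) (filter-reject (λ v → a v ≟ j) (j≢ ∘ sym))))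
    (cong (c x *_) (sym (product-by-level c uniq xs (levels ∘ there)))))

  product-choiceCount : ∀ {L : List ℤ} → Unique L → (∀ x → a x ∈ L) → (∀ {i} → i ∈ L → 0 < levelCount a i) →
    product (tabulate choiceCount) ≡ product (map (λ i → descentCount i * stepCount i ^ (levelCount a i ∸ 1)) L)
  product-choiceCount {L} uniq levels inhabited = trans (cong product (sym (map-tabulate id choiceCount)))
    (trans (product-by-level choiceCount uniq (allFin n) (λ _ → levels _))
      (cong product (map-cong-∈ λ {i} m → at-level i (inhabited m))))
    where
    at-level : ∀ i → 0 < levelCount a i →
      product (map choiceCount (filter (λ v → a v ≟ i) (allFin n))) ≡ descentCount i * stepCount i ^ (levelCount a i ∸ 1)
    at-level i pos = product-one-special choiceCount (filter⁺ _ (allFin⁺ n))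
      (∈-filter⁺ (λ v → a v ≟ i) (∈-allFin s) level-s) at-s others
      where
      -- Positivity provides some vertex of the level; its representative is the one exceptional
      -- factor.
      first = Inverse.from (level-size i) (fromℕ< pos)
      s = rep a (proj₁ first)
      level-s : a s ≡ i
      level-s = trans (rep-level a _) (proj₂ first)
      at-s : choiceCount s ≡ descentCount i
      at-s with rep a s Finₚ.≟ s
      ... | yes _ = cong descentCount level-s
      ... | no ne = ⊥-elim (ne (rep-idem a _))
      others : ∀ {x} → x ∈ filter (λ v → a v ≟ i) (allFin n) → x ≢ s → choiceCount x ≡ stepCount i
      others {x} m x≢s with rep a x Finₚ.≟ x
      ... | yes e = ⊥-elim (x≢s (trans (sym e) (rep-cong a (trans (level-∈⁻ m) (sym (proj₂ first))))))
      ... | no _ = cong stepCount (level-∈⁻ m)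

-- The count

Embedded-resp : ∀ {n} {a a' : Fin n → ℤ} {Eρ} → a ≗ a' → Embedded a Eρ → Embedded a' Eρ
Embedded-resp {Eρ = E , ρ} e (tree , aρ , step) =
  tree , trans (sym (e ρ)) aρ , λ u v p → trans (cong₂ (λ i j → ∣ i - j ∣) (sym (e u)) (sym (e v))) (step u v p)

product-* : {A : Set} (f g : A → ℕ) (L : List A) →
  product (map (λ x → f x * g x) L) ≡ product (map f L) * product (map g L)
product-* f g [] = refl
product-* f g (x ∷ L) = trans (cong (f x * g x *_) (product-* f g L)) (interchange (f x) (g x) _ _)
  where
  interchange : ∀ w x y z → w * x * (y * z) ≡ w * y * (x * z)
  interchange = solve-∀ℕ

-- Products over consecutive levels

∏ : ℕ → (ℕ → ℕ) → ℕ
∏ n f = product (applyUpTo f n)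

∏-cong : ∀ n {f g : ℕ → ℕ} → (∀ k → k < n → f k ≡ g k) → ∏ n f ≡ ∏ n g
∏-cong zero _ = refl
∏-cong (suc n) e = cong₂ _*_ (e 0 (s≤s z≤n)) (∏-cong n (λ k k<n → e (suc k) (s≤s k<n)))

∏-split : ∀ m n f → ∏ (m + n) f ≡ ∏ m f * ∏ n (λ k → f (m + k))
∏-split zero n f = sym (ℕₚ.*-identityˡ _)
∏-split (suc m) n f = trans (cong (f 0 *_) (∏-split m n (f ∘ suc))) (sym (ℕₚ.*-assoc (f 0) _ _))

∏-last : ∀ n f → ∏ (suc n) f ≡ ∏ n f * f n
∏-last zero f = ℕₚ.*-comm (f 0) 1
∏-last (suc n) f = trans (cong (f 0 *_) (∏-last n (f ∘ suc))) (sym (ℕₚ.*-assoc (f 0) _ _))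

i+[j-i]≡j : ∀ i j → i ℤ.+ (j - i) ≡ j
i+[j-i]≡j = solve-∀

module _ {ℓ r : ℤ} where

  ∈-range⁻ : ℓ ≤ r → ∀ {i} → i ∈ range ℓ r → ℓ ≤ i × i ≤ r
  ∈-range⁻ ℓ≤r m with ∈-map⁻ (λ k → ℓ ℤ.+ + k) m
  ... | k , k∈ , refl = ℤₚ.i≤i+j ℓ (+ k) , subst (ℓ ℤ.+ + k ≤_) top (ℤₚ.+-monoʳ-≤ ℓ (ℤ.+≤+ (ℕₚ.≤-pred (∈-upTo⁻ k∈))))
    where
    top : ℓ ℤ.+ + ∣ r - ℓ ∣ ≡ r
    top = trans (cong (λ i → ℓ ℤ.+ i) (ℤₚ.0≤i⇒+∣i∣≡i (ℤₚ.i≤j⇒0≤j-i ℓ≤r))) (i+[j-i]≡j ℓ r)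

  ∈-range⁺ : ∀ {i} → ℓ ≤ i → i ≤ r → i ∈ range ℓ r
  ∈-range⁺ {i} ℓ≤i i≤r = subst (_∈ range ℓ r)
    (trans (cong (λ j → ℓ ℤ.+ j) i-ℓ) (i+[j-i]≡j ℓ i))
    (∈-map⁺ (λ k → ℓ ℤ.+ + k) (∈-upTo⁺ (s≤s (ℤₚ.drop‿+≤+ (ℤₚ.≤-trans (ℤₚ.≤-reflexive i-ℓ)
      (ℤₚ.≤-trans (ℤₚ.+-monoˡ-≤ (ℤ.- ℓ) i≤r) (ℤₚ.≤-reflexive (sym r-ℓ))))))))
    where
    i-ℓ : + ∣ i - ℓ ∣ ≡ i - ℓ
    i-ℓ = ℤₚ.0≤i⇒+∣i∣≡i (ℤₚ.i≤j⇒0≤j-i ℓ≤i)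
    r-ℓ : + ∣ r - ℓ ∣ ≡ r - ℓ
    r-ℓ = ℤₚ.0≤i⇒+∣i∣≡i (ℤₚ.i≤j⇒0≤j-i (ℤₚ.≤-trans ℓ≤i i≤r))

  range-unique : Unique (range ℓ r)
  range-unique = map⁺ (λ e → ℤₚ.+-injective (∙-cancelˡ (AbelianGroup.group ℤₚ.+-0-abelianGroup) ℓ _ _ e)) (upTo⁺ _)

  ext-inside : ∀ (m : ℤ → ℕ) {i} → ℓ ≤ i → i ≤ r → ext ℓ r m i ≡ m i
  ext-inside m {i} ℓ≤i i≤r with ℓ ℤ.≤? i | i ℤ.≤? r
  ... | yes _ | yes _ = refl
  ... | no ℓ≰i | _ = ⊥-elim (ℓ≰i ℓ≤i)
  ... | yes _ | no i≰r = ⊥-elim (i≰r i≤r)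

  ext-support : ∀ (m : ℤ → ℕ) i → 0 < ext ℓ r m i → i ∈ range ℓ r
  ext-support m i pos with ℓ ℤ.≤? i | i ℤ.≤? r
  ... | yes ℓ≤i | yes i≤r = ∈-range⁺ ℓ≤i i≤r

  towardZero : (ℤ → ℕ) → ℤ → ℕ
  towardZero m (+ 0) = 1
  towardZero m +[1+ k ] = ext ℓ r m (+[1+ k ] - + 1)
  towardZero m -[1+ k ] = ext ℓ r m (-[1+ k ] ℤ.+ + 1)

  bothSides : (ℤ → ℕ) → ℤ → ℕ
  bothSides m i = ext ℓ r m (i - + 1) + ext ℓ r m (i ℤ.+ + 1)

-- Below 0 each level contributes the size of the next one up, above 0 that of the next one down.
-- The two end levels are thus missing and level 0 is free to occur from both sides; supplying the
-- ends gives the products over `ℓ`, ..., 0 and over 0, ..., `r`, which together contain `m (+ 0)`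
-- once more than the full product.
∏-towardZero-ℕ : ∀ p q (m : ℤ → ℕ) → let ℓ = ℤ.- (+ p) ; r = + q in
  product (map (towardZero {ℓ} {r} m) (range ℓ r)) * (m ℓ * m r) ≡ m (+ 0) * product (map m (range ℓ r))
∏-towardZero-ℕ p q m = begin
  product (map G (range ℓ r)) * (m ℓ * m r)
    ≡⟨ cong₂ _*_ (trans (reindex G) ∏G) (cong₂ (λ i j → m i * m j) (sym (ℤₚ.+-identityʳ ℓ)) (sym (shift q))) ⟩
  ∏ p (X ∘ suc) * ∏ q (λ k → X (p + k)) * (X 0 * X (p + q))
    ≡⟨ regroup (∏ p (X ∘ suc)) _ (X 0) (X (p + q)) ⟩
  ∏ (suc p) X * (∏ q (λ k → X (p + k)) * X (p + q))
    ≡⟨ cong₂ _*_ (∏-last p X) (sym (∏-last q (λ k → X (p + k)))) ⟩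
  ∏ p X * X p * ∏ (suc q) (λ k → X (p + k))
    ≡⟨ regroup' (∏ p X) (X p) _ ⟩
  X p * (∏ p X * ∏ (suc q) (λ k → X (p + k)))
    ≡⟨ cong₂ _*_ (cong m (ℤₚ.+-inverseˡ (+ p))) (sym (∏-split p (suc q) X)) ⟩
  m (+ 0) * ∏ (p + suc q) X
    ≡⟨ cong (m (+ 0) *_) (reindex m) ⟨
  m (+ 0) * product (map m (range ℓ r)) ∎
  where
  open ≡-Reasoning
  ℓ = ℤ.- (+ p)
  r = + q
  G = towardZero {ℓ} {r} m
  -- Levels are indexed by their distance from `ℓ`, so index `p` is level 0.
  X : ℕ → ℕ
  X k = m (ℓ ℤ.+ + k)
  regroup : ∀ w x y z → w * x * (y * z) ≡ y * w * (x * z)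
  regroup = solve-∀ℕ
  regroup' : ∀ x y z → x * y * z ≡ y * (x * z)
  regroup' = solve-∀ℕ
  cancel : ∀ i j → ℤ.- i ℤ.+ (i ℤ.+ j) ≡ j
  cancel = solve-∀
  shift : ∀ k → ℓ ℤ.+ + (p + k) ≡ + k
  shift k = cancel (+ p) (+ k)
  w = suc ∣ r - ℓ ∣
  width : suc ∣ r - ℓ ∣ ≡ p + suc q
  width = trans (cong suc (trans (cong (λ i → ∣ r ℤ.+ i ∣) (ℤₚ.neg-involutive (+ p))) (ℕₚ.+-comm q p)))
    (sym (ℕₚ.+-suc p q))
  reindex : ∀ (f : ℤ → ℕ) → product (map f (range ℓ r)) ≡ ∏ (p + suc q) (λ k → f (ℓ ℤ.+ + k))
  reindex f = trans
    (cong product (trans (sym (map-∘ {g = f} {f = λ k → ℓ ℤ.+ + k} (upTo w))) (map-upTo (λ k → f (ℓ ℤ.+ + k)) w)))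
    (cong (λ n → ∏ n (λ k → f (ℓ ℤ.+ + k))) width)
  ℓ≤0 : ℓ ≤ + 0
  ℓ≤0 = ℤₚ.neg-mono-≤ (ℤ.+≤+ z≤n)
  negative : ∀ {i} → i ℤ.< + 0 → G i ≡ ext ℓ r m (i ℤ.+ + 1)
  negative ℤ.-<+ = refl
  below : ∀ k → k < p → G (ℓ ℤ.+ + k) ≡ X (suc k)
  below k k<p = trans (negative (subst (ℓ ℤ.+ + k ℤ.<_) (ℤₚ.+-inverseˡ (+ p)) (ℤₚ.+-monoʳ-< ℓ (ℤ.+<+ k<p))))
    (trans (cong (ext ℓ r m) (trans (ℤₚ.+-assoc ℓ (+ k) (+ 1)) (cong (λ j → ℓ ℤ.+ + j) (ℕₚ.+-comm k 1))))
      (ext-inside m (ℤₚ.i≤i+j ℓ (+ suc k)) (ℤₚ.≤-trans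
        (subst (ℓ ℤ.+ + suc k ≤_) (ℤₚ.+-inverseˡ (+ p)) (ℤₚ.+-monoʳ-≤ ℓ (ℤ.+≤+ k<p))) (ℤ.+≤+ z≤n))))
  above : ∀ k → k < q → G (ℓ ℤ.+ + (p + suc k)) ≡ X (p + k)
  above k k<q = trans (cong G (shift (suc k))) (trans
    (ext-inside m (ℤₚ.≤-trans ℓ≤0 (ℤ.+≤+ z≤n)) (ℤ.+≤+ (ℕₚ.<⇒≤ k<q))) (cong m (sym (shift k))))
  ∏G : ∏ (p + suc q) (λ k → G (ℓ ℤ.+ + k)) ≡ ∏ p (X ∘ suc) * ∏ q (λ k → X (p + k))
  ∏G = trans (∏-split p (suc q) _) (cong₂ _*_ (∏-cong p below)
    (trans (cong₂ _*_ (cong G (shift 0)) (∏-cong q above)) (ℕₚ.*-identityˡ _)))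

∏-towardZero : ∀ {ℓ r} (m : ℤ → ℕ) → ℓ ≤ + 0 → + 0 ≤ r →
  product (map (towardZero {ℓ} {r} m) (range ℓ r)) * (m ℓ * m r) ≡ m (+ 0) * product (map m (range ℓ r))
∏-towardZero {+ 0} {+ q} m _ _ = ∏-towardZero-ℕ 0 q m
∏-towardZero { -[1+ p ]} {+ q} m _ _ = ∏-towardZero-ℕ (suc p) q m
∏-towardZero {+[1+ _ ]} m (ℤ.+≤+ ())
∏-towardZero {r = -[1+ _ ]} m _ ()

module _ (ℓ r : ℤ) (m : ℤ → ℕ) (ℓ≤0 : ℓ ≤ + 0) (0≤r : + 0 ≤ r)
         (positive : (i : ℤ) → ℓ ≤ i → i ≤ r → 0 < m i) where
  private
    L = range ℓ r
    n = size ℓ r m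
    ℓ≤r = ℤₚ.≤-trans ℓ≤0 0≤r
    G = towardZero {ℓ} {r} m
    F = bothSides {ℓ} {r} m

    ext-∈ : ∀ {i} → i ∈ L → ext ℓ r m i ≡ m i
    ext-∈ i∈L = let (ℓ≤i , i≤r) = ∈-range⁻ ℓ≤r i∈L in ext-inside m ℓ≤i i≤r

    ext-sum : sum (map (ext ℓ r m) L) ≡ n
    ext-sum = cong sum (map-cong-∈ ext-∈)

  labelCount treeCount : ℕ
  labelCount = multinomial n (ext ℓ r m) L
  treeCount = product (map (λ i → G i * F i ^ (m i ∸ 1)) L)

  trees-over-labels : (a : Fin n → ℤ) → HasProfile ℓ r m a →
    HasSize (Sub RootedGraphSetoid (Embedded a)) treeCount
  trees-over-labels a profile = subst (HasSize _)
    (trans (product-choiceCount a {L} (range-unique {ℓ} {r})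
             (λ x → ext-support {ℓ} {r} m (a x) (subst (0 <_) (profile (a x)) (occupied x))) inhabited)
           (cong product (map-cong-∈ λ {i} i∈L → cong₂ _*_ (descents i)
             (cong₂ _^_ (steps i) (cong (_∸ 1) (trans (profile i) (ext-∈ i∈L)))))))
    (trees-size a (proj₁ zero-level) (proj₂ zero-level))
    where
    inhabited : ∀ {i} → i ∈ L → 0 < levelCount a i
    inhabited {i} i∈L = let (ℓ≤i , i≤r) = ∈-range⁻ ℓ≤r i∈L in
      subst (0 <_) (sym (trans (profile i) (ext-∈ i∈L))) (positive i ℓ≤i i≤r)
    zero-level : ∃ λ x → a x ≡ + 0
    zero-level = from (level-size a (+ 0)) (fromℕ< (inhabited (∈-range⁺ ℓ≤0 0≤r)))
    occupied : ∀ x → 0 < levelCount a (a x)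
    -- The number assigned to `x` is an element of `Fin` of the level count, which rules out zero.
    occupied x with levelCount a (a x) | to (level-size a (a x)) (x , refl)
    ... | suc _ | _ = s≤s z≤n
    descents : ∀ i → descentCount a i ≡ G i
    descents (+ 0) = refl
    descents +[1+ k ] = profile _
    descents -[1+ k ] = profile _
    steps : ∀ i → stepCount a i ≡ F i
    steps i = cong₂ _+_ (profile _) (profile _)

  profiled-size : HasSize (ProfiledSetoid ℓ r m) (labelCount * treeCount)
  profiled-size = Compose.inverse
    (mkInverse
      (λ (t , profile) → let open EmbTree t in (emb , (edges , root)) , profile , isTree , emb-root , emb-edge)
      (λ ((a , (E , ρ)) , profile , tree , aρ , step) →
        record { edges = E ; root = ρ ; emb = a ; isTree = tree ; emb-root = aρ ; emb-edge = step } , profile)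
      (λ (e , r , a) → a , e , r) (λ (a , e , r) → e , r , a)
      (λ _ → (λ _ → refl) , (λ _ _ → refl) , refl) (λ _ → (λ _ _ → refl) , refl , (λ _ → refl)))
    (HasSize-Σ {A = Fin n →-setoid ℤ} {B = RootedGraphSetoid} (λ e → Embedded-resp e)
      (multinomial-labels (range-unique {ℓ} {r}) n (ext ℓ r m) (ext-support {ℓ} {r} m) ext-sum) trees-over-labels)

  -- The factor `m ℓ * m r` completes the product of the descents to `m (+ 0)` times all level
  -- sizes. Those sizes turn the factorials of `m i ∸ 1` into the full factorials that clear the
  -- multinomial coefficient.
  count-formula : labelCount * treeCount * denom ℓ r m ≡ numer ℓ r m
  count-formula = begin
    labelCount * treeCount * (m ℓ * m r * ∏f)
      ≡⟨ cong (λ t → labelCount * t * (m ℓ * m r * ∏f)) (product-* G (λ i → F i ^ (m i ∸ 1)) L) ⟩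
    labelCount * (∏G * ∏F) * (m ℓ * m r * ∏f)
      ≡⟨ regroup labelCount ∏G ∏F (m ℓ * m r) ∏f ⟩
    labelCount * (∏G * (m ℓ * m r) * ∏f) * ∏F
      ≡⟨ cong (λ t → labelCount * (t * ∏f) * ∏F) (∏-towardZero m ℓ≤0 0≤r) ⟩
    labelCount * (m (+ 0) * ∏m * ∏f) * ∏F
      ≡⟨ regroup' labelCount (m (+ 0)) ∏m ∏f ∏F ⟩
    m (+ 0) * (labelCount * (∏m * ∏f)) * ∏F
      ≡⟨ cong (λ t → m (+ 0) * (labelCount * t) * ∏F) (sym factorials) ⟩
    m (+ 0) * (labelCount * product (map (λ i → ext ℓ r m i !) L)) * ∏F
      ≡⟨ cong (λ t → m (+ 0) * t * ∏F) (multinomial-factorials (range-unique {ℓ} {r}) n (ext ℓ r m) ext-sum) ⟩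
    m (+ 0) * n ! * ∏F ∎
    where
    open ≡-Reasoning
    ∏G = product (map G L)
    ∏F = product (map (λ i → F i ^ (m i ∸ 1)) L)
    ∏f = product (map (λ i → (m i ∸ 1) !) L)
    ∏m = product (map m L)
    regroup : ∀ l g f e h → l * (g * f) * (e * h) ≡ l * (g * e * h) * f
    regroup = solve-∀ℕ
    regroup' : ∀ l z u h f → l * (z * u * h) * f ≡ z * (l * (u * h)) * f
    regroup' = solve-∀ℕ
    n!≡n*[n∸1]! : ∀ k → 0 < k → k ! ≡ k * (k ∸ 1) !
    n!≡n*[n∸1]! (suc k) _ = refl
    factorials : product (map (λ i → ext ℓ r m i !) L) ≡ ∏m * ∏f
    factorials = trans
      (cong product (map-cong-∈ λ {i} i∈L → let (ℓ≤i , i≤r) = ∈-range⁻ ℓ≤r i∈L in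
        trans (cong _! (ext-∈ i∈L)) (n!≡n*[n∸1]! (m i) (positive i ℓ≤i i≤r))))
      (product-* m (λ i → (m i ∸ 1) !) L)

theorem1p2 : (ℓ r : ℤ) (m : ℤ → ℕ) → ℓ ≤ + 0 → + 0 ≤ r →
    ((i : ℤ) → ℓ ≤ i → i ≤ r → 0 < m i) →
    Σ ℕ λ N → Inverse (ProfiledSetoid ℓ r m) (setoid (Fin N)) × (N * denom ℓ r m ≡ numer ℓ r m)
-- The witness is read off from `profiled-size`: labellings times trees per labelling.
theorem1p2 ℓ r m ℓ≤0 0≤r positive = _
  , profiled-size ℓ r m ℓ≤0 0≤r positive
  , count-formula ℓ r m ℓ≤0 0≤r positive
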